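{- There are terms $i,o$ of Gödel's $T$ such that $\textsf{E-PRA}^{\omega*}$ proves: for all $\mu^2$ and all $\Theta$, \[ [\textsf{MU}(\mu)\wedge\textsf{SFF}(\Theta)]\rightarrow(\forall X^1)\Big[(\forall g\in i(X,\mu,\Theta))\,\textsf{WO}(g,X)\rightarrow(\exists Y^1\in o(X,\mu,\Theta))\,H_{\theta_0}(X,Y)\Big], \] where $\theta_0(n,Z)$ expresses that $n^0$ is a member of the Turing jump of $Z^1$.
   Context: Types: $0$ is the type of natural numbers, $1=0\to0$, $2=1\to0$, and $\tau^*$ is the type of finite sequences of objects of type $\tau$; for $w$ of type $\tau^*$, $g\in w$ means $g$ equals one of the entries of $w$. $\textsf{E-PRA}^{\omega}$ is Kohlenbach's extensional primitive recursive arithmetic in all finite types (classical logic, extensionality, combinators, the type-$0$ primitive recursor, quantifier-free induction); $\textsf{E-PRA}^{\omega*}$ is its definitional extension with types $\tau^*$. The outputs $i(X,\mu,\Theta)$ and $o(X,\mu,\Theta)$ are of type $1^*$. $\textsf{MU}(\mu)$, for $\mu^2$ (Feferman's search operator): $(\forall f^1)\big((\exists n^0)(f(n)=0)\to f(\mu(f))=0\big)$. $\textsf{SFF}(\Theta)$, for $\Theta$ of type $2\to1^*$ (special fan functional): $(\forall G^2)(\forall f^1\leq_11)(\exists g\in\Theta(G))\big(f\in[\overline{g}G(g)]\big)$, where $f\leq_11$ means $f(n)\le1$ for all $n$, $\overline{g}N=\langle g(0),\dots,g(N-1)\rangle$, and $f\in[\sigma]$ means that $f$ extends $\sigma$. $\textsf{WO}(g,X)$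 is the arithmetical formula expressing that ($X$ codes a countable linear ordering and) $g^1$ is not an infinite descending sequence through $X$; thus $(\forall g^1)\textsf{WO}(g,X)$ says that $X$ is a countable well-ordering. For arithmetical $\theta$, $H_\theta(X,Y)$ says that $Y$ results from iterating $\theta$ along $X$, i.e. $Y=\{(n,j):j\in\text{field}(X)\wedge\theta(n,Y^j)\}$ with $Y^j=\{(m,i)\in Y:i<_Xj\}$ (sets coded by characteristic functions). -}

module Defs where

open import Data.List using (List; []; _∷_; map)
open import Data.List.Membership.Propositional using (_∈_)
open import Data.List.Relation.Unary.Any using (here; there)
open import Data.Maybe using (Maybe; just; nothing; maybe′; zipWith)
open import Relation.Binary.PropositionalEquality using (refl)

infixr 7 _⇒_
infix  8 _⋆

data Ty : Set where
  ι   : Ty               -- the type 0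
  _⇒_ : Ty → Ty → Ty
  _⋆  : Ty → Ty

𝟙 𝟚 : Ty
𝟙 = ι ⇒ ι
𝟚 = 𝟙 ⇒ ι

Ctx : Set
Ctx = List Ty

variable
  ρ σ τ : Ty
  Γ Δ : Ctx

infixl 20 _·_

-- The terms of the language of E-PRA^ω*: those terms of Gödel's T, with
-- sequence types added, in which only recursion at type 0 is used.
-- A sequence w of type τ⋆ is given by its length len w and its entries
-- at w 0, …, at w (len w - 1); seq n f is the sequence ⟨f 0, …, f (n - 1)⟩.
-- The recursor R takes the recursion argument first.
data Tm (Γ : Ctx) : Ty → Set where
  var : τ ∈ Γ → Tm Γ τ
  _·_ : Tm Γ (σ ⇒ τ) → Tm Γ σ → Tm Γ τ
  O   : Tm Γ ι
  Sc  : Tm Γ (ι ⇒ ι)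
  K   : Tm Γ (σ ⇒ τ ⇒ σ)
  S   : Tm Γ ((ρ ⇒ σ ⇒ τ) ⇒ (ρ ⇒ σ) ⇒ ρ ⇒ τ)
  R   : Tm Γ (ι ⇒ ι ⇒ (ι ⇒ ι ⇒ ι) ⇒ ι)
  len : Tm Γ (τ ⋆ ⇒ ι)
  at  : Tm Γ (τ ⋆ ⇒ ι ⇒ τ)
  seq : Tm Γ (ι ⇒ (ι ⇒ τ) ⇒ τ ⋆)

Sub : Ctx → Ctx → Set
Sub Γ Δ = ∀ {τ} → τ ∈ Γ → Tm Δ τ

subT : Sub Γ Δ → Tm Γ τ → Tm Δ τ
subT s (var x) = s x
subT s (t · u) = subT s t · subT s u
subT s O       = O
subT s Sc      = Sc
subT s K       = K
subT s S       = S
subT s R       = R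
subT s len     = len
subT s at      = at
subT s seq     = seq

infix 25 _↑

_↑ : Tm Γ τ → Tm (σ ∷ Γ) τ
_↑ = subT (λ x → var (there x))

lift : Sub Γ Δ → Sub (σ ∷ Γ) (σ ∷ Δ)
lift s (here refl) = var (here refl)
lift s (there x)   = s x ↑

infix 25 _₀

_₀ : Tm [] τ → Tm Γ τ
_₀ = subT λ ()

v0 : Tm (ρ ∷ Γ) ρ
v0 = var (here refl)

v1 : Tm (σ ∷ ρ ∷ Γ) ρ
v1 = v0 ↑

v2 : Tm (τ ∷ σ ∷ ρ ∷ Γ) ρ
v2 = v1 ↑

v3 : ∀ {υ} → Tm (υ ∷ τ ∷ σ ∷ ρ ∷ Γ) ρ
v3 = v2 ↑

v4 : ∀ {υ υ′} → Tm (υ′ ∷ υ ∷ τ ∷ σ ∷ ρ ∷ Γ) ρ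
v4 = v3 ↑

v5 : ∀ {υ υ′ υ″} → Tm (υ″ ∷ υ′ ∷ υ ∷ τ ∷ σ ∷ ρ ∷ Γ) ρ
v5 = v4 ↑

infix  4 _≐_
infixr 3 _∧̇_
infixr 2 _∨̇_
infixr 1 _⊃_
infix  1 _⇔̇_

-- Equality of objects of type 0 is the only primitive predicate.
data Fm (Γ : Ctx) : Set where
  _≐_         : Tm Γ ι → Tm Γ ι → Fm Γ
  ⊥̇           : Fm Γ
  _∧̇_ _∨̇_ _⊃_ : Fm Γ → Fm Γ → Fm Γ
  ∀̇ ∃̇         : (σ : Ty) → Fm (σ ∷ Γ) → Fm Γ

¬̇_ : Fm Γ → Fm Γ
¬̇ φ = φ ⊃ ⊥̇

infix 6 ¬̇_

_⇔̇_ : Fm Γ → Fm Γ → Fm Γ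
φ ⇔̇ ψ = (φ ⊃ ψ) ∧̇ (ψ ⊃ φ)

subF : Sub Γ Δ → Fm Γ → Fm Δ
subF s (t ≐ u)  = subT s t ≐ subT s u
subF s ⊥̇        = ⊥̇
subF s (φ ∧̇ ψ)  = subF s φ ∧̇ subF s ψ
subF s (φ ∨̇ ψ)  = subF s φ ∨̇ subF s ψ
subF s (φ ⊃ ψ)  = subF s φ ⊃ subF s ψ
subF s (∀̇ σ φ)  = ∀̇ σ (subF (lift s) φ)
subF s (∃̇ σ φ)  = ∃̇ σ (subF (lift s) φ)

wkF : Fm Γ → Fm (σ ∷ Γ)
wkF = subF (λ x → var (there x))

inst : Tm Γ σ → Sub (σ ∷ Γ) Γ
inst t (here refl) = t
inst t (there x)   = var x

_[_] : Fm (σ ∷ Γ) → Tm Γ σ → Fm Γ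
φ [ t ] = subF (inst t) φ

-- φ(Sc x), with x the innermost variable of φ
sucInst : Sub (ι ∷ Γ) (ι ∷ Γ)
sucInst (here refl) = Sc · v0
sucInst (there x)   = var (there x)

data QF {Γ : Ctx} : Fm Γ → Set where
  atom : ∀ {t u} → QF (t ≐ u)
  bot  : QF ⊥̇
  and  : ∀ {φ ψ} → QF φ → QF ψ → QF (φ ∧̇ ψ)
  or   : ∀ {φ ψ} → QF φ → QF ψ → QF (φ ∨̇ ψ)
  imp  : ∀ {φ ψ} → QF φ → QF ψ → QF (φ ⊃ ψ)

-- λ-abstraction by combinators: lam t stands for λx.t, where x is the
-- innermost variable.  The function strengthen succeeds exactly on the
-- terms in which x does not occur; these are abstracted by K.

strengthen : Tm (σ ∷ Γ) τ → Maybe (Tm Γ τ)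
strengthen (var (here _))  = nothing
strengthen (var (there x)) = just (var x)
strengthen (t · u)         = zipWith _·_ (strengthen t) (strengthen u)
strengthen O               = just O
strengthen Sc              = just Sc
strengthen K               = just K
strengthen S               = just S
strengthen R               = just R
strengthen len             = just len
strengthen at              = just at
strengthen seq             = just seq

lam : Tm (σ ∷ Γ) τ → Tm Γ (σ ⇒ τ)
lam {σ} (var (here refl)) = S · K · K {τ = σ}
lam (var (there x))       = K · var x
lam (t · u)               = maybe′ (K ·_) (S · lam t · lam u) (strengthen (t · u))
lam O                     = K · O
lam Sc                    = K · Sc
lam K                     = K · K
lam S                     = K · S
lam R                     = K · R
lam len                   = K · len
lam at                    = K · at
lam seq                   = K · seq

infixl 16 _∔_ _∸̇_

one : Tm Γ ι
one = Sc · O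

plus : Tm Γ (ι ⇒ ι ⇒ ι)
plus = lam (lam (R · v0 · v1 · lam (lam (Sc · v1))))

_∔_ : Tm Γ ι → Tm Γ ι → Tm Γ ι
t ∔ u = plus · t · u

pred : Tm Γ (ι ⇒ ι)
pred = lam (R · v0 · O · lam (lam v0))

monus : Tm Γ (ι ⇒ ι ⇒ ι)
monus = lam (lam (R · v0 · v1 · lam (lam (pred · v1))))

_∸̇_ : Tm Γ ι → Tm Γ ι → Tm Γ ι
t ∸̇ u = monus · t · u

cond : Tm Γ (ι ⇒ ι ⇒ ι ⇒ ι)
cond = lam (lam (lam (R · v2 · v1 · lam (lam v2))))

ifz : Tm Γ ι → Tm Γ ι → Tm Γ ι → Tm Γ ι
ifz t u v = cond · t · u · v

dist : Tm Γ ι → Tm Γ ι → Tm Γ ι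
dist t u = (t ∸̇ u) ∔ (u ∸̇ t)

infix 4 _≤̇_ _<̇_

_≤̇_ _<̇_ : Tm Γ ι → Tm Γ ι → Fm Γ
t ≤̇ u = t ∸̇ u ≐ O
t <̇ u = Sc · t ≤̇ u

eq : (τ : Ty) → Tm Γ τ → Tm Γ τ → Fm Γ
eq ι       t u = t ≐ u
eq (σ ⇒ τ) t u = ∀̇ σ (eq τ (t ↑ · v0) (u ↑ · v0))
eq (τ ⋆)   t u = (len · t ≐ len · u)
               ∧̇ ∀̇ ι (v0 <̇ len · t ↑ ⊃ eq τ (at · t ↑ · v0) (at · u ↑ · v0))

infix 4 _≈_

_≈_ : Tm Γ τ → Tm Γ τ → Fm Γ
_≈_ {τ = τ} = eq τ

zeroT : (τ : Ty) → Tm Γ τ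
zeroT ι       = O
zeroT (σ ⇒ τ) = K · zeroT τ
zeroT (τ ⋆)   = seq · O · (K · zeroT τ)

-- The last three schemata define sequences: τ⋆ is definable as the type of
-- pairs of a length and a function 0 → τ, taken up to the equality eq (τ ⋆).
-- The quantifier-free formulas in qf-ind may contain parameters of all types.
data Axiom {Γ : Ctx} : Fm Γ → Set where
  ≐-refl  : ∀ t → Axiom (t ≐ t)
  ≐-sym   : ∀ t u → Axiom (t ≐ u ⊃ u ≐ t)
  ≐-trans : ∀ t u v → Axiom (t ≐ u ⊃ u ≐ v ⊃ t ≐ v)
  Sc-inj  : ∀ t u → Axiom (Sc · t ≐ Sc · u ⊃ t ≐ u)
  Sc≢O    : ∀ t → Axiom (¬̇ (Sc · t ≐ O))
  ext     : (z : Tm Γ (σ ⇒ τ)) (x y : Tm Γ σ) → Axiom (x ≈ y ⊃ z · x ≈ z · y)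
  K-eq    : (x : Tm Γ σ) (y : Tm Γ τ) → Axiom (K · x · y ≈ x)
  S-eq    : (x : Tm Γ (ρ ⇒ σ ⇒ τ)) (y : Tm Γ (ρ ⇒ σ)) (z : Tm Γ ρ) →
            Axiom (S · x · y · z ≈ x · z · (y · z))
  R-O     : ∀ y z → Axiom (R · O · y · z ≐ y)
  R-Sc    : ∀ x y z → Axiom (R · (Sc · x) · y · z ≐ z · (R · x · y · z) · x)
  qf-ind  : (φ : Fm (ι ∷ Γ)) → QF φ →
            Axiom (φ [ O ] ⊃ ∀̇ ι (φ ⊃ subF sucInst φ) ⊃ ∀̇ ι φ)
  len-seq : (n : Tm Γ ι) (f : Tm Γ (ι ⇒ τ)) → Axiom (len · (seq · n · f) ≐ n)
  at-seq  : (n i : Tm Γ ι) (f : Tm Γ (ι ⇒ τ)) →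
            Axiom (i <̇ n ⊃ at · (seq · n · f) · i ≈ f · i)
  at-out  : (w : Tm Γ (τ ⋆)) (i : Tm Γ ι) →
            Axiom (len · w ≤̇ i ⊃ at · w · i ≈ zeroT τ)

infix 0 _⊢_

data _⊢_ {Γ : Ctx} (Φ : List (Fm Γ)) : Fm Γ → Set where
  ax  : ∀ {φ} → Axiom φ → Φ ⊢ φ
  hyp : ∀ {φ} → φ ∈ Φ → Φ ⊢ φ
  ⊃I  : ∀ {φ ψ} → φ ∷ Φ ⊢ ψ → Φ ⊢ φ ⊃ ψ
  ⊃E  : ∀ {φ ψ} → Φ ⊢ φ ⊃ ψ → Φ ⊢ φ → Φ ⊢ ψ
  ∧I  : ∀ {φ ψ} → Φ ⊢ φ → Φ ⊢ ψ → Φ ⊢ φ ∧̇ ψ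
  ∧E₁ : ∀ {φ ψ} → Φ ⊢ φ ∧̇ ψ → Φ ⊢ φ
  ∧E₂ : ∀ {φ ψ} → Φ ⊢ φ ∧̇ ψ → Φ ⊢ ψ
  ∨I₁ : ∀ {φ ψ} → Φ ⊢ φ → Φ ⊢ φ ∨̇ ψ
  ∨I₂ : ∀ {φ ψ} → Φ ⊢ ψ → Φ ⊢ φ ∨̇ ψ
  ∨E  : ∀ {φ ψ χ} → Φ ⊢ φ ∨̇ ψ → φ ∷ Φ ⊢ χ → ψ ∷ Φ ⊢ χ → Φ ⊢ χ
  raa : ∀ {φ} → ¬̇ φ ∷ Φ ⊢ ⊥̇ → Φ ⊢ φ
  ∀I  : ∀ {φ} → map wkF Φ ⊢ φ → Φ ⊢ ∀̇ σ φ
  ∀E  : ∀ {φ} → Φ ⊢ ∀̇ σ φ → (t : Tm Γ σ) → Φ ⊢ φ [ t ]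
  ∃I  : ∀ {φ} (t : Tm Γ σ) → Φ ⊢ φ [ t ] → Φ ⊢ ∃̇ σ φ
  ∃E  : ∀ {φ ψ} → Φ ⊢ ∃̇ σ φ → φ ∷ map wkF Φ ⊢ wkF ψ → Φ ⊢ ψ

E-PRAω⋆⊢_ : Fm [] → Set
E-PRAω⋆⊢ φ = [] ⊢ φ

infix 0 E-PRAω⋆⊢_

infix 4 _∈̇_

_∈̇_ : Tm Γ τ → Tm Γ (τ ⋆) → Fm Γ
g ∈̇ w = ∃̇ ι (v0 <̇ len · w ↑ ∧̇ g ↑ ≈ at · w ↑ · v0)

∀∈ ∃∈ : Tm Γ (τ ⋆) → Fm (τ ∷ Γ) → Fm Γ
∀∈ {τ = τ} w φ = ∀̇ τ (v0 ∈̇ w ↑ ⊃ φ)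
∃∈ {τ = τ} w φ = ∃̇ τ (v0 ∈̇ w ↑ ∧̇ φ)

MU : Tm Γ 𝟚 → Fm Γ
MU μ = ∀̇ 𝟙 (∃̇ ι (v1 · v0 ≐ O) ⊃ v0 · (μ ↑ · v0) ≐ O)

_≤₁one : Tm Γ 𝟙 → Fm Γ
f ≤₁one = ∀̇ ι (f ↑ · v0 ≤̇ one)

_∈[_] : Tm Γ 𝟙 → Tm Γ (ι ⋆) → Fm Γ
f ∈[ s ] = ∀̇ ι (v0 <̇ len · s ↑ ⊃ f ↑ · v0 ≐ at · s ↑ · v0)

-- In the scope of the quantifiers, v2 is G, v1 is f and v0 is g.
SFF : Tm Γ (𝟚 ⇒ 𝟙 ⋆) → Fm Γ
SFF Θ = ∀̇ 𝟚 (∀̇ 𝟙 (v0 ≤₁one ⊃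
          ∃∈ (Θ ↑ ↑ · v1) (v1 ∈[ seq · (v2 · v0) · v0 ])))

-- Cantor's pairing ⟨m , n⟩ = (m + n)(m + n + 1)/2 + n, a bijection, and
-- its inverse

tri : Tm Γ (ι ⇒ ι)
tri = lam (R · v0 · O · lam (lam (v1 ∔ Sc · v0)))

pair : Tm Γ (ι ⇒ ι ⇒ ι)
pair = lam (lam (tri · (v1 ∔ v0) ∔ v0))

⟨_,_⟩ : Tm Γ ι → Tm Γ ι → Tm Γ ι
⟨ t , u ⟩ = pair · t · u

-- The largest d with tri d ≤ z; this is m + n when z = ⟨m , n⟩.
diag : Tm Γ (ι ⇒ ι)
diag = lam (R · v0 · O ·
         lam (lam (ifz (tri · (Sc · v1) ∸̇ Sc · v0) (Sc · v1) v1)))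

snd fst : Tm Γ (ι ⇒ ι)
snd = lam (v0 ∸̇ tri · (diag · v0))
fst = lam (diag · v0 ∸̇ snd · v0)

-- A number c codes the infinite sequence fst c, fst (snd c),
-- fst (snd (snd c)), …, which is eventually 0 since ⟨0 , 0⟩ = 0.

drop : Tm Γ (ι ⇒ ι ⇒ ι)
drop = lam (lam (R · v1 · v0 · lam (lam (snd · v1))))

entry : Tm Γ (ι ⇒ ι ⇒ ι)
entry = lam (lam (fst · (drop · v1 · v0)))

-- update i c x replaces entry number i of c by x: starting from the code of
-- x followed by the entries after i, the entries i - 1, …, 0 of c are
-- put in front.
update : Tm Γ (ι ⇒ ι ⇒ ι ⇒ ι)
update = lam (lam (lam
  (R · v2 · ⟨ v0 , drop · (Sc · v2) · v1 ⟩ ·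
    lam (lam ⟨ entry · (v4 ∸̇ Sc · v0) · v3 , v1 ⟩))))

-- The Turing jump is defined by counter machines with an oracle.
-- A machine with code e = ⟨ℓ , c⟩ has the instructions number 0, …, ℓ - 1,
-- namely the entries of c, and registers number 0, 1, 2, ….  A state is
-- ⟨p , r⟩, where p is the number of the next instruction and entry a of r
-- is the content of register a; the machine has halted when p ≥ ℓ.
-- The instructions ⟨k , ⟨a , q⟩⟩ are
--   k = 0:  increase register a by 1;
--   k = 1:  if register a is 0 then jump to instruction q,
--           else decrease register a by 1;
--   k ≥ 2:  replace the content x of register a by Z x.

-- The effect of the instruction ⟨k , ⟨a , q⟩⟩ on the state ⟨p , r⟩ if x is
-- in register a.  The first case is k = 1 and x = 0, where dist k one is
-- |k - 1|.
exec : Tm Γ (𝟙 ⇒ ι ⇒ ι ⇒ ι ⇒ ι ⇒ ι ⇒ ι ⇒ ι)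
exec = lam (lam (lam (lam (lam (lam (lam (
  ifz (dist k one ∔ x)
    ⟨ q , r ⟩
    ⟨ Sc · p , update · a · r ·
      ifz k (Sc · x) (ifz (k ∸̇ one) (pred · x) (Z · x)) ⟩)))))))
  where
  Z : Tm (ι ∷ ι ∷ ι ∷ ι ∷ ι ∷ ι ∷ 𝟙 ∷ Δ) 𝟙
  Z = v5 ↑
  p r k a q x : Tm (ι ∷ ι ∷ ι ∷ ι ∷ ι ∷ ι ∷ 𝟙 ∷ Δ) ι
  p = v5
  r = v4
  k = v3
  a = v2
  q = v1
  x = v0

instr : Tm Γ (𝟙 ⇒ ι ⇒ ι ⇒ ι ⇒ ι)
instr = lam (lam (lam (lam
  (exec · Z · p · r · (fst · c) · a · (snd · (snd · c)) · (entry · a · r)))))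
  where
  Z : Tm (ι ∷ ι ∷ ι ∷ 𝟙 ∷ Δ) 𝟙
  Z = v3
  p r c a : Tm (ι ∷ ι ∷ ι ∷ 𝟙 ∷ Δ) ι
  p = v2
  r = v1
  c = v0
  a = fst · (snd · c)

step : Tm Γ (𝟙 ⇒ ι ⇒ ι ⇒ ι)
step = lam (lam (lam
  (ifz (fst · e ∸̇ fst · s) s
       (instr · Z · (fst · s) · (snd · s) · (entry · (fst · s) · (snd · e))))))
  where
  Z : Tm (ι ∷ ι ∷ 𝟙 ∷ Δ) 𝟙
  Z = v2
  e s : Tm (ι ∷ ι ∷ 𝟙 ∷ Δ) ι
  e = v1
  s = v0

-- run Z e t is the state after t steps of machine e with oracle Z, started
-- at instruction 0 with e in register 0 and 0 in all other registers.
run : Tm Γ (𝟙 ⇒ ι ⇒ ι ⇒ ι)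
run = lam (lam (lam
  (R · v0 · ⟨ O , ⟨ v1 , O ⟩ ⟩ · lam (lam (step · v4 · v3 · v1)))))

-- n is in the Turing jump of Z if machine n with oracle Z halts on input n.
θ₀ : Fm (ι ∷ 𝟙 ∷ [])
θ₀ = ∃̇ ι (fst · v1 ≤̇ fst · (run · v2 · v1 · v0))

-- A set is given by its characteristic function X, and n ∈ X means X n = 1.

infix 4 _ε_

_ε_ : Tm Γ ι → Tm Γ 𝟙 → Fm Γ
n ε X = X · n ≐ one

IsSet : Tm Γ 𝟙 → Fm Γ
IsSet X = X ≤₁one

infix 4 _≤⟨_⟩_ _<⟨_⟩_

_≤⟨_⟩_ _<⟨_⟩_ : Tm Γ ι → Tm Γ 𝟙 → Tm Γ ι → Fm Γ
i ≤⟨ X ⟩ j = ⟨ i , j ⟩ ε X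
i <⟨ X ⟩ j = i ≤⟨ X ⟩ j ∧̇ ¬̇ (j ≤⟨ X ⟩ i)

_∈field_ : Tm Γ ι → Tm Γ 𝟙 → Fm Γ
i ∈field X = i ≤⟨ X ⟩ i

infix 4 _∈field_

LO : Tm Γ 𝟙 → Fm Γ
LO X =
    ∀̇ ι (∀̇ ι (v1 ≤⟨ X ↑ ↑ ⟩ v0 ⊃ v1 ∈field X ↑ ↑ ∧̇ v0 ∈field X ↑ ↑))
  ∧̇ ∀̇ ι (∀̇ ι (∀̇ ι (v2 ≤⟨ X ↑ ↑ ↑ ⟩ v1 ∧̇ v1 ≤⟨ X ↑ ↑ ↑ ⟩ v0 ⊃ v2 ≤⟨ X ↑ ↑ ↑ ⟩ v0)))
  ∧̇ ∀̇ ι (∀̇ ι (v1 ≤⟨ X ↑ ↑ ⟩ v0 ∧̇ v0 ≤⟨ X ↑ ↑ ⟩ v1 ⊃ v1 ≐ v0))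
  ∧̇ ∀̇ ι (∀̇ ι (v1 ∈field X ↑ ↑ ∧̇ v0 ∈field X ↑ ↑ ⊃
                v1 ≤⟨ X ↑ ↑ ⟩ v0 ∨̇ v0 ≤⟨ X ↑ ↑ ⟩ v1))

WO : Tm Γ 𝟙 → Tm Γ 𝟙 → Fm Γ
WO g X = LO X ∧̇ ¬̇ ∀̇ ι (g ↑ · (Sc · v0) <⟨ X ↑ ⟩ g ↑ · v0)

-- below X Y j is the characteristic function of
-- Y^j = {⟨m , i⟩ ∈ Y : i <_X j}.
below : Tm Γ (𝟙 ⇒ 𝟙 ⇒ ι ⇒ 𝟙)
below = lam (lam (lam (lam (
  ifz (dist (v2 · v0) one)
    (ifz (dist (v3 · ⟨ snd · v0 , v1 ⟩) one)
      (ifz (dist (v3 · ⟨ v1 , snd · v0 ⟩) one) O one)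
      O)
    O))))

inst₂ : Tm Γ σ → Tm Γ τ → Sub (σ ∷ τ ∷ []) Γ
inst₂ t u (here refl)         = t
inst₂ t u (there (here refl)) = u

-- Since pairing is bijective, the second conjunct determines the set Y.
H : Fm (ι ∷ 𝟙 ∷ []) → Tm Γ 𝟙 → Tm Γ 𝟙 → Fm Γ
H θ X Y =
    IsSet Y
  ∧̇ ∀̇ ι (∀̇ ι (⟨ v1 , v0 ⟩ ε Y ↑ ↑ ⇔̇
      v0 ∈field X ↑ ↑ ∧̇
      subF (inst₂ v1 (below · X ↑ ↑ · Y ↑ ↑ · v0)) θ))

{-# OPTIONS --safe #-}

-- For Z of type 1 let J Z p say whether snd p is in the field of X and fst p is in the jump of
-- below X Z (snd p).  The fixed points of J are the jump hierarchies along X.  Write q < p if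
-- snd q <_X snd p, and call Z wrong at p if Z p ≠ J Z p.  With μ one obtains a functional G with
-- G Z = p + 1 for some p at which Z is wrong and below which it is right, if there is such a p.
-- Let Z₀, Z₁, … be the entries of Θ G and let W p = J Z_a p for some a such that Z_a is right
-- below p.  By SFF, W extends the first G Z_b values of some Z_b.  If Z_b were wrong somewhere,
-- then G Z_b = p + 1 for some p as above; Z_a and Z_b would be right, hence equal, below p, so
-- that W p = J Z_a p = J Z_b p ≠ Z_b p, a contradiction.  So Z_b is a jump hierarchy.
--
-- Well-foundedness is used twice: a wrong Z_a is wrong at some p below which it is right, and
-- Z_a and Z_b agree at p if both are right at p and below p.  The p that witness a failure of
-- either form one arithmetical set with no minimal element (Bad).  Hence it suffices that
-- i(X,μ,Θ) has a single entry, the sequence that descends through this set by means of μ.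
--
-- Derivations are given for variables in place of J, G, W, …, and instantiated by closure of
-- derivability under substitution, so that the (large) terms themselves are never computed with.

module Submission where

open import Defs
open import Data.List using (List; []; _∷_; map)
open import Data.List.Membership.Propositional using (_∈_)
open import Data.List.Membership.Propositional.Properties using (∈-map⁺; ∈-map⁻)
open import Data.List.Relation.Unary.Any using (here; there)
open import Data.Maybe using (just; nothing)
open import Data.Product using (Σ-syntax) renaming (_,_ to _,,_)
open import Relation.Binary.PropositionalEquality using (_≡_; refl; sym; trans; cong; cong₂; subst)

variable
  Φ Ψ : List (Fm Γ)
  φ ψ χ : Fm Γ
  Ξ : Ctx
  υ : Ty

infixl 5 _▹_

_▹_ : Sub Γ Δ → Tm Δ σ → Sub (σ ∷ Γ) Δ
(s ▹ t) (here refl) = t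
(s ▹ t) (there x)   = s x

wk : Sub Γ (σ ∷ Γ)
wk x = var (there x)

⊢≡ : φ ≡ ψ → Φ ⊢ φ → Φ ⊢ ψ
⊢≡ refl p = p

-- Substitution

subT-cong : {s s′ : Sub Γ Δ} → (∀ {τ} (x : τ ∈ Γ) → s x ≡ s′ x) →
            (t : Tm Γ τ) → subT s t ≡ subT s′ t
subT-cong e (var x) = e x
subT-cong e (t · u) = cong₂ _·_ (subT-cong e t) (subT-cong e u)
subT-cong e O       = refl
subT-cong e Sc      = refl
subT-cong e K       = refl
subT-cong e S       = refl
subT-cong e R       = refl
subT-cong e len     = refl
subT-cong e at      = refl
subT-cong e seq     = refl

subT-∘ : (s′ : Sub Δ Ξ) (s : Sub Γ Δ) (t : Tm Γ τ) →
         subT s′ (subT s t) ≡ subT (λ x → subT s′ (s x)) t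
subT-∘ s′ s (var x) = refl
subT-∘ s′ s (t · u) = cong₂ _·_ (subT-∘ s′ s t) (subT-∘ s′ s u)
subT-∘ s′ s O       = refl
subT-∘ s′ s Sc      = refl
subT-∘ s′ s K       = refl
subT-∘ s′ s S       = refl
subT-∘ s′ s R       = refl
subT-∘ s′ s len     = refl
subT-∘ s′ s at      = refl
subT-∘ s′ s seq     = refl

subT-var : (t : Tm Γ τ) → subT var t ≡ t
subT-var (var x) = refl
subT-var (t · u) = cong₂ _·_ (subT-var t) (subT-var u)
subT-var O       = refl
subT-var Sc      = refl
subT-var K       = refl
subT-var S       = refl
subT-var R       = refl
subT-var len     = refl
subT-var at      = refl
subT-var seq     = refl

subT-∘-cong : (s′ : Sub Δ Ξ) (s : Sub Γ Δ) {r : Sub Γ Ξ} →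
              (∀ {τ} (x : τ ∈ Γ) → subT s′ (s x) ≡ r x) →
              (t : Tm Γ τ) → subT s′ (subT s t) ≡ subT r t
subT-∘-cong s′ s e t = trans (subT-∘ s′ s t) (subT-cong e t)

subT-lift-↑ : (s : Sub Γ Δ) (t : Tm Γ τ) → subT (lift {σ = σ} s) (t ↑) ≡ subT s t ↑
subT-lift-↑ s t = trans (subT-∘ _ _ t) (sym (subT-∘ _ _ t))

subT-▹-↑ : (s : Sub Γ Δ) (u : Tm Δ σ) (t : Tm Γ τ) → subT (s ▹ u) (t ↑) ≡ subT s t
subT-▹-↑ s u = subT-∘ _ _

inst-↑ : (u : Tm Γ σ) (t : Tm Γ τ) → subT (inst u) (t ↑) ≡ t
inst-↑ u t = trans (subT-∘ _ _ t) (subT-var t)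

lift-cong : {s s′ : Sub Γ Δ} → (∀ {τ} (x : τ ∈ Γ) → s x ≡ s′ x) →
            ∀ {τ} (x : τ ∈ σ ∷ Γ) → lift s x ≡ lift s′ x
lift-cong e (here refl) = refl
lift-cong e (there x)   = cong _↑ (e x)

subF-cong : {s s′ : Sub Γ Δ} → (∀ {τ} (x : τ ∈ Γ) → s x ≡ s′ x) →
            (φ : Fm Γ) → subF s φ ≡ subF s′ φ
subF-cong e (t ≐ u)  = cong₂ _≐_ (subT-cong e t) (subT-cong e u)
subF-cong e ⊥̇        = refl
subF-cong e (φ ∧̇ ψ)  = cong₂ _∧̇_ (subF-cong e φ) (subF-cong e ψ)
subF-cong e (φ ∨̇ ψ)  = cong₂ _∨̇_ (subF-cong e φ) (subF-cong e ψ)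
subF-cong e (φ ⊃ ψ)  = cong₂ _⊃_ (subF-cong e φ) (subF-cong e ψ)
subF-cong e (∀̇ σ φ)  = cong (∀̇ σ) (subF-cong (lift-cong e) φ)
subF-cong e (∃̇ σ φ)  = cong (∃̇ σ) (subF-cong (lift-cong e) φ)

lift-∘ : (s′ : Sub Δ Ξ) (s : Sub Γ Δ) {r : Sub Γ Ξ} →
         (∀ {τ} (x : τ ∈ Γ) → subT s′ (s x) ≡ r x) →
         ∀ {τ} (x : τ ∈ σ ∷ Γ) → subT (lift s′) (lift s x) ≡ lift r x
lift-∘ s′ s e (here refl) = refl
lift-∘ s′ s e (there x)   = trans (subT-lift-↑ s′ (s x)) (cong _↑ (e x))

subF-∘-cong : (s′ : Sub Δ Ξ) (s : Sub Γ Δ) {r : Sub Γ Ξ} →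
              (∀ {τ} (x : τ ∈ Γ) → subT s′ (s x) ≡ r x) →
              (φ : Fm Γ) → subF s′ (subF s φ) ≡ subF r φ
subF-∘-cong s′ s e (t ≐ u)  = cong₂ _≐_ (subT-∘-cong s′ s e t) (subT-∘-cong s′ s e u)
subF-∘-cong s′ s e ⊥̇        = refl
subF-∘-cong s′ s e (φ ∧̇ ψ)  = cong₂ _∧̇_ (subF-∘-cong s′ s e φ) (subF-∘-cong s′ s e ψ)
subF-∘-cong s′ s e (φ ∨̇ ψ)  = cong₂ _∨̇_ (subF-∘-cong s′ s e φ) (subF-∘-cong s′ s e ψ)
subF-∘-cong s′ s e (φ ⊃ ψ)  = cong₂ _⊃_ (subF-∘-cong s′ s e φ) (subF-∘-cong s′ s e ψ)
subF-∘-cong s′ s e (∀̇ σ φ)  = cong (∀̇ σ) (subF-∘-cong (lift s′) (lift s) (lift-∘ s′ s e) φ)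
subF-∘-cong s′ s e (∃̇ σ φ)  = cong (∃̇ σ) (subF-∘-cong (lift s′) (lift s) (lift-∘ s′ s e) φ)

lift-var : (x : τ ∈ σ ∷ Γ) → lift var x ≡ var x
lift-var (here refl) = refl
lift-var (there x)   = refl

subF-var : (φ : Fm Γ) → subF var φ ≡ φ
subF-var (t ≐ u)  = cong₂ _≐_ (subT-var t) (subT-var u)
subF-var ⊥̇        = refl
subF-var (φ ∧̇ ψ)  = cong₂ _∧̇_ (subF-var φ) (subF-var ψ)
subF-var (φ ∨̇ ψ)  = cong₂ _∨̇_ (subF-var φ) (subF-var ψ)
subF-var (φ ⊃ ψ)  = cong₂ _⊃_ (subF-var φ) (subF-var ψ)
subF-var (∀̇ σ φ)  = cong (∀̇ σ) (trans (subF-cong lift-var φ) (subF-var φ))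
subF-var (∃̇ σ φ)  = cong (∃̇ σ) (trans (subF-cong lift-var φ) (subF-var φ))

inst-lift-wk : (φ : Fm (σ ∷ Γ)) → subF (lift wk) φ [ v0 ] ≡ φ
inst-lift-wk φ = trans
  (subF-∘-cong (inst v0) (lift wk) (λ { (here refl) → refl ; (there x) → refl }) φ) (subF-var φ)

subF-lift-wkF : (s : Sub Γ Δ) (φ : Fm Γ) → subF (lift {σ = σ} s) (wkF φ) ≡ wkF (subF s φ)
subF-lift-wkF s φ = trans (subF-∘-cong _ _ (λ x → refl) φ) (sym (subF-∘-cong _ _ (λ x → refl) φ))

subF-inst : (s : Sub Γ Δ) (φ : Fm (σ ∷ Γ)) (t : Tm Γ σ) →
            subF s (φ [ t ]) ≡ subF (lift s) φ [ subT s t ]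
subF-inst s φ t =
  trans (subF-∘-cong s (inst t) {r = λ x → subT s (inst t x)} (λ x → refl) φ)
        (sym (subF-∘-cong (inst (subT s t)) (lift s)
               (λ { (here refl) → refl ; (there x) → inst-↑ _ (s x) }) φ))

subF-sucInst : (s : Sub Γ Δ) (φ : Fm (ι ∷ Γ)) →
               subF (lift s) (subF sucInst φ) ≡ subF sucInst (subF (lift s) φ)
subF-sucInst s φ =
  trans (subF-∘-cong (lift s) sucInst {r = λ x → subT (lift s) (sucInst x)} (λ x → refl) φ)
        (sym (subF-∘-cong sucInst (lift s)
               (λ { (here refl) → refl ; (there x) → subT-∘ _ _ (s x) }) φ))

subF-eq : (s : Sub Γ Δ) (τ : Ty) (t u : Tm Γ τ) → subF s (eq τ t u) ≡ eq τ (subT s t) (subT s u)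
subF-eq s ι       t u = refl
subF-eq s (σ ⇒ τ) t u = cong (∀̇ σ) (trans (subF-eq (lift s) τ _ _)
  (cong₂ (λ t′ u′ → eq τ (t′ · v0) (u′ · v0)) (subT-lift-↑ s t) (subT-lift-↑ s u)))
subF-eq s (τ ⋆)   t u = cong₂ (λ φ ψ → (len · subT s t ≐ len · subT s u) ∧̇ ∀̇ ι (φ ⊃ ψ))
  (cong (λ t′ → v0 <̇ len · t′) (subT-lift-↑ s t))
  (trans (subF-eq (lift s) τ _ _)
    (cong₂ (λ t′ u′ → eq τ (at · t′ · v0) (at · u′ · v0)) (subT-lift-↑ s t) (subT-lift-↑ s u)))

subT-zeroT : (s : Sub Γ Δ) (τ : Ty) → subT s (zeroT τ) ≡ zeroT τ
subT-zeroT s ι       = refl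
subT-zeroT s (σ ⇒ τ) = cong (K ·_) (subT-zeroT s τ)
subT-zeroT s (τ ⋆)   = cong (λ z → seq · O · (K · z)) (subT-zeroT s τ)

-- Derivations are closed under substitution

subQF : (s : Sub Γ Δ) → QF φ → QF (subF s φ)
subQF s atom      = atom
subQF s bot       = bot
subQF s (and a b) = and (subQF s a) (subQF s b)
subQF s (or a b)  = or (subQF s a) (subQF s b)
subQF s (imp a b) = imp (subQF s a) (subQF s b)

subAxiom : (s : Sub Γ Δ) → Axiom φ → Axiom (subF s φ)
subAxiom s (≐-refl t)      = ≐-refl _
subAxiom s (≐-sym t u)     = ≐-sym _ _
subAxiom s (≐-trans t u v) = ≐-trans _ _ _
subAxiom s (Sc-inj t u)    = Sc-inj _ _
subAxiom s (Sc≢O t)        = Sc≢O _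
subAxiom s (ext {σ} {τ} z x y) =
  subst Axiom (sym (cong₂ _⊃_ (subF-eq s σ x y) (subF-eq s τ (z · x) (z · y)))) (ext _ _ _)
subAxiom s (K-eq {σ} x y)  = subst Axiom (sym (subF-eq s σ _ _)) (K-eq _ _)
subAxiom s (S-eq {τ = τ} x y z) = subst Axiom (sym (subF-eq s τ _ _)) (S-eq _ _ _)
subAxiom s (R-O y z)       = R-O _ _
subAxiom s (R-Sc x y z)    = R-Sc _ _ _
subAxiom s (qf-ind φ q)    = subst Axiom
  (sym (cong₂ (λ α β → α ⊃ ∀̇ ι (subF (lift s) φ ⊃ β) ⊃ ∀̇ ι (subF (lift s) φ))
          (subF-inst s φ O) (subF-sucInst s φ)))
  (qf-ind (subF (lift s) φ) (subQF (lift s) q))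
subAxiom s (len-seq n f)   = len-seq _ _
subAxiom s (at-seq {τ} n i f) =
  subst Axiom (sym (cong (subT s i <̇ subT s n ⊃_) (subF-eq s τ _ _))) (at-seq _ _ _)
subAxiom s (at-out {τ} w i) =
  subst Axiom (sym (cong (len · subT s w ≤̇ subT s i ⊃_)
    (trans (subF-eq s τ _ _) (cong (eq τ _) (subT-zeroT s τ))))) (at-out _ _)

-- Inclusion after substitution instead of the exact list `map (subF s) Φ`: weakening then becomes
-- the case of the identity substitution.
_⊑⟨_⟩_ : List (Fm Γ) → Sub Γ Δ → List (Fm Δ) → Set
Φ ⊑⟨ s ⟩ Ψ = ∀ {φ} → φ ∈ Φ → subF s φ ∈ Ψ

⊑-∷ : {s : Sub Γ Δ} → Φ ⊑⟨ s ⟩ Ψ → (φ ∷ Φ) ⊑⟨ s ⟩ (subF s φ ∷ Ψ)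
⊑-∷ e (here refl) = here refl
⊑-∷ e (there h)   = there (e h)

⊑-lift : {s : Sub Γ Δ} → Φ ⊑⟨ s ⟩ Ψ → map (wkF {σ = σ}) Φ ⊑⟨ lift s ⟩ map wkF Ψ
⊑-lift {s = s} e h with ∈-map⁻ wkF h
... | φ ,, φ∈ ,, refl = subst (_∈ _) (sym (subF-lift-wkF s φ)) (∈-map⁺ wkF (e φ∈))

sub⊢ : (s : Sub Γ Δ) → Φ ⊑⟨ s ⟩ Ψ → Φ ⊢ φ → Ψ ⊢ subF s φ
sub⊢ s e (ax a)       = ax (subAxiom s a)
sub⊢ s e (hyp h)      = hyp (e h)
sub⊢ s e (⊃I p)       = ⊃I (sub⊢ s (⊑-∷ e) p)
sub⊢ s e (⊃E p q)     = ⊃E (sub⊢ s e p) (sub⊢ s e q)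
sub⊢ s e (∧I p q)     = ∧I (sub⊢ s e p) (sub⊢ s e q)
sub⊢ s e (∧E₁ p)      = ∧E₁ (sub⊢ s e p)
sub⊢ s e (∧E₂ p)      = ∧E₂ (sub⊢ s e p)
sub⊢ s e (∨I₁ p)      = ∨I₁ (sub⊢ s e p)
sub⊢ s e (∨I₂ p)      = ∨I₂ (sub⊢ s e p)
sub⊢ s e (∨E p q r)   = ∨E (sub⊢ s e p) (sub⊢ s (⊑-∷ e) q) (sub⊢ s (⊑-∷ e) r)
sub⊢ s e (raa p)      = raa (sub⊢ s (⊑-∷ e) p)
sub⊢ s e (∀I p)       = ∀I (sub⊢ (lift s) (⊑-lift e) p)
sub⊢ s e (∀E {φ = φ} p t) = ⊢≡ (sym (subF-inst s φ t)) (∀E (sub⊢ s e p) (subT s t))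
sub⊢ s e (∃I {φ = φ} t p) = ∃I (subT s t) (⊢≡ (subF-inst s φ t) (sub⊢ s e p))
sub⊢ s e (∃E {ψ = ψ} p q) = ∃E (sub⊢ s e p)
  (⊢≡ (subF-lift-wkF s ψ) (sub⊢ (lift s) (⊑-∷ (⊑-lift e)) q))

weaken : (∀ {χ} → χ ∈ Φ → χ ∈ Ψ) → Φ ⊢ φ → Ψ ⊢ φ
weaken {φ = φ} e p = ⊢≡ (subF-var φ)
  (sub⊢ var (λ {χ} h → subst (_∈ _) (sym (subF-var χ)) (e h)) p)

wk∷ : Φ ⊢ φ → ψ ∷ Φ ⊢ φ
wk∷ = weaken there

wk⊢ : Φ ⊢ φ → map (wkF {σ = σ}) Φ ⊢ wkF φ
wk⊢ = sub⊢ wk (∈-map⁺ wkF)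

at⟨_⟩ : (s : Sub Γ Δ) → [] ⊢ φ → Ψ ⊢ subF s φ
at⟨ s ⟩ = sub⊢ s λ ()

h0 : φ ∷ Φ ⊢ φ
h0 = hyp (here refl)

-- Equality in all finite types

wk≈ : (t u : Tm Γ τ) → Φ ⊢ t ≈ u → map (wkF {σ = σ}) Φ ⊢ t ↑ ≈ u ↑
wk≈ {τ = τ} t u p = ⊢≡ (subF-eq wk τ t u) (wk⊢ p)

app≈ : (t u : Tm Γ (σ ⇒ τ)) → Φ ⊢ t ≈ u → (x : Tm Γ σ) → Φ ⊢ t · x ≈ u · x
app≈ {τ = τ} t u p x = ⊢≡
  (trans (subF-eq (inst x) τ _ _)
    (cong₂ (λ t′ u′ → eq τ (t′ · x) (u′ · x)) (inst-↑ x t) (inst-↑ x u)))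
  (∀E p x)

sym≐ : {t u : Tm Γ ι} → Φ ⊢ t ≐ u → Φ ⊢ u ≐ t
sym≐ p = ⊃E (ax (≐-sym _ _)) p

trans≐ : {t u v : Tm Γ ι} → Φ ⊢ t ≐ u → Φ ⊢ u ≐ v → Φ ⊢ t ≐ v
trans≐ p q = ⊃E (⊃E (ax (≐-trans _ _ _)) p) q

ap≈ : (z : Tm Γ (σ ⇒ τ)) (x y : Tm Γ σ) → Φ ⊢ x ≈ y → Φ ⊢ z · x ≈ z · y
ap≈ z x y p = ⊃E (ax (ext z x y)) p

ap≐ : (z : Tm Γ (ι ⇒ τ)) {x y : Tm Γ ι} → Φ ⊢ x ≐ y → Φ ⊢ z · x ≈ z · y
ap≐ z {x} {y} p = ap≈ z x y p

at≈ : (t u : Tm Γ (τ ⋆)) → Φ ⊢ t ≈ u → (n : Tm Γ ι) → Φ ⊢ n <̇ len · t → Φ ⊢ at · t · n ≈ at · u · n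
at≈ {τ = τ} t u p n q = ⊃E (⊢≡
  (cong₂ _⊃_ (cong (λ t′ → n <̇ len · t′) (inst-↑ n t))
     (trans (subF-eq (inst n) τ _ _)
       (cong₂ (λ t′ u′ → eq τ (at · t′ · n) (at · u′ · n)) (inst-↑ n t) (inst-↑ n u))))
  (∀E (∧E₂ p) n)) q

sym≈ : (t u : Tm Γ τ) → Φ ⊢ t ≈ u → Φ ⊢ u ≈ t
sym≈ {τ = ι}     t u p = sym≐ p
sym≈ {τ = σ ⇒ τ} t u p = ∀I (sym≈ (t ↑ · v0) (u ↑ · v0) (app≈ (t ↑) (u ↑) (wk≈ t u p) v0))
sym≈ {τ = τ ⋆}   t u p = ∧I (sym≐ (∧E₁ p)) (∀I (⊃I (sym≈ (at · t ↑ · v0) (at · u ↑ · v0)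
  -- The hypothesis bounds the index by the length of `u`. As `<̇` abbreviates an equation about
  -- `monus`, the equality of the lengths rewrites it into the bound required for `t`.
  (at≈ (t ↑) (u ↑) p′ v0 (trans≐ (ap≐ (monus · (Sc · v0)) (∧E₁ p′)) h0)))))
  where
  p′ = wk∷ (wk≈ t u p)

trans≈ : (t u v : Tm Γ τ) → Φ ⊢ t ≈ u → Φ ⊢ u ≈ v → Φ ⊢ t ≈ v
trans≈ {τ = ι}     t u v p q = trans≐ p q
trans≈ {τ = σ ⇒ τ} t u v p q = ∀I (trans≈ (t ↑ · v0) (u ↑ · v0) (v ↑ · v0)
  (app≈ (t ↑) (u ↑) (wk≈ t u p) v0) (app≈ (u ↑) (v ↑) (wk≈ u v q) v0))
trans≈ {τ = τ ⋆}   t u v p q = ∧I (trans≐ (∧E₁ p) (∧E₁ q)) (∀I (⊃I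
  (trans≈ (at · t ↑ · v0) (at · u ↑ · v0) (at · v ↑ · v0)
    (at≈ (t ↑) (u ↑) p′ v0 h0)
    (at≈ (u ↑) (v ↑) q′ v0 (trans≐ (ap≐ (monus · (Sc · v0)) (sym≐ (∧E₁ p′))) h0)))))
  where
  p′ = wk∷ (wk≈ t u p)
  q′ = wk∷ (wk≈ u v q)

cong≈ : (f g : Tm Γ (σ ⇒ τ)) (x y : Tm Γ σ) → Φ ⊢ f ≈ g → Φ ⊢ x ≈ y → Φ ⊢ f · x ≈ g · y
cong≈ f g x y p q = trans≈ (f · x) (g · x) (g · y) (app≈ f g p x) (ap≈ g x y q)

-- β-conversion, under a substitution so that it applies below binders

strengthen-▹ : (t : Tm (σ ∷ Γ) τ) {t′ : Tm Γ τ} (s : Sub Γ Δ) (u : Tm Δ σ) →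
               strengthen t ≡ just t′ → subT (s ▹ u) t ≡ subT s t′
strengthen-▹ (var (there x)) s u refl = refl
strengthen-▹ (t · t′) s u e with strengthen t in e₁ | strengthen t′ in e₂
strengthen-▹ (t · t′) s u refl | just _ | just _ =
  cong₂ _·_ (strengthen-▹ t s u e₁) (strengthen-▹ t′ s u e₂)
strengthen-▹ O   s u refl = refl
strengthen-▹ Sc  s u refl = refl
strengthen-▹ K   s u refl = refl
strengthen-▹ S   s u refl = refl
strengthen-▹ R   s u refl = refl
strengthen-▹ len s u refl = refl
strengthen-▹ at  s u refl = refl
strengthen-▹ seq s u refl = refl

β : (t : Tm (σ ∷ Γ) τ) (s : Sub Γ Δ) (u : Tm Δ σ) → Φ ⊢ subT s (lam t) · u ≈ subT (s ▹ u) t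
β {σ} (var (here refl)) s u =
  trans≈ (S · K · K {τ = σ} · u) (K · u · (K {τ = σ} · u)) u (ax (S-eq _ _ _)) (ax (K-eq _ _))
β (var (there x)) s u = ax (K-eq _ _)
-- The cases follow those of `lam`: an application without the abstracted variable was abstracted by
-- a single `K`, any other one by `S`.
β (t · t′) s u with strengthen (t · t′) in e
... | just r = ⊢≡ (cong (K · subT s r · u ≈_) (sym (strengthen-▹ (t · t′) s u e))) (ax (K-eq _ _))
... | nothing =
  trans≈ (S · subT s (lam t) · subT s (lam t′) · u)
         (subT s (lam t) · u · (subT s (lam t′) · u)) (subT (s ▹ u) (t · t′))
    (ax (S-eq _ _ _))
    (cong≈ (subT s (lam t) · u) (subT (s ▹ u) t) (subT s (lam t′) · u) (subT (s ▹ u) t′)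
      (β t s u) (β t′ s u))
β O   s u = ax (K-eq O u)
β Sc  s u = ax (K-eq Sc u)
β K   s u = ax (K-eq K u)
β S   s u = ax (K-eq S u)
β R   s u = ax (K-eq R u)
β len s u = ax (K-eq len u)
β at  s u = ax (K-eq at u)
β seq s u = ax (K-eq seq u)

β₂ : (t : Tm (ρ ∷ σ ∷ Γ) τ) (s : Sub Γ Δ) (u : Tm Δ σ) (v : Tm Δ ρ) →
     Φ ⊢ subT s (lam (lam t)) · u · v ≈ subT (s ▹ u ▹ v) t
β₂ t s u v = trans≈ (subT s (lam (lam t)) · u · v) (subT (s ▹ u) (lam t) · v) (subT (s ▹ u ▹ v) t)
  (app≈ (subT s (lam (lam t)) · u) (subT (s ▹ u) (lam t)) (β (lam t) s u) v) (β t (s ▹ u) v)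

β₃ : (t : Tm (υ ∷ ρ ∷ σ ∷ Γ) τ) (s : Sub Γ Δ) (u : Tm Δ σ) (v : Tm Δ ρ) (w : Tm Δ υ) →
     Φ ⊢ subT s (lam (lam (lam t))) · u · v · w ≈ subT (s ▹ u ▹ v ▹ w) t
β₃ t s u v w =
  trans≈ (subT s (lam (lam (lam t))) · u · v · w) (subT (s ▹ u ▹ v) (lam t) · w) (subT (s ▹ u ▹ v ▹ w) t)
  (app≈ (subT s (lam (lam (lam t))) · u · v) (subT (s ▹ u ▹ v) (lam t)) (β₂ (lam t) s u v) w)
  (β t (s ▹ u ▹ v) w)

-- Arithmetic

infixr 4 _⊙_

_⊙_ : {t u v : Tm Γ ι} → Φ ⊢ t ≐ u → Φ ⊢ u ≐ v → Φ ⊢ t ≐ v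
_⊙_ = trans≐

refl≐ : {t : Tm Γ ι} → Φ ⊢ t ≐ t
refl≐ = ax (≐-refl _)

ap₂≐ : (f : Tm Γ (ι ⇒ ι ⇒ ι)) {t t′ u u′ : Tm Γ ι} →
       Φ ⊢ t ≐ t′ → Φ ⊢ u ≐ u′ → Φ ⊢ f · t · u ≐ f · t′ · u′
ap₂≐ f p q = cong≈ (f · _) (f · _) _ _ (ap≐ f p) q

S≐ : {t t′ : Tm Γ ι} → Φ ⊢ t ≐ t′ → Φ ⊢ Sc · t ≐ Sc · t′
S≐ = ap≐ Sc

⊥E : Φ ⊢ ⊥̇ → Φ ⊢ φ
⊥E p = raa (wk∷ p)

S≢O : {t : Tm Γ ι} → Φ ⊢ Sc · t ≐ O → Φ ⊢ φ
S≢O p = ⊥E (⊃E (ax (Sc≢O _)) p)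

+O : (t : Tm Γ ι) → Φ ⊢ t ∔ O ≐ t
+O t = β₂ (R · v0 · v1 · lam (lam (Sc · v1))) var t O ⊙ ax (R-O _ _)

+S : (t u : Tm Γ ι) → Φ ⊢ t ∔ Sc · u ≐ Sc · (t ∔ u)
+S t u = β₂ b var t (Sc · u) ⊙ ax (R-Sc _ _ _) ⊙ β₂ (Sc · v1) var _ u
       ⊙ S≐ (sym≐ (β₂ b var t u))
  where
  b = R · v0 · v1 · lam (lam (Sc · v1))

predO : Φ ⊢ pred · O ≐ O
predO = β (R · v0 · O · lam (lam v0)) var O ⊙ ax (R-O _ _)

predS : (t : Tm Γ ι) → Φ ⊢ pred · (Sc · t) ≐ t
predS t = β (R · v0 · O · lam (lam v0)) var (Sc · t) ⊙ ax (R-Sc _ _ _) ⊙ β₂ v0 var _ t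

∸O : (t : Tm Γ ι) → Φ ⊢ t ∸̇ O ≐ t
∸O t = β₂ (R · v0 · v1 · lam (lam (pred · v1))) var t O ⊙ ax (R-O _ _)

∸S : (t u : Tm Γ ι) → Φ ⊢ t ∸̇ Sc · u ≐ pred · (t ∸̇ u)
∸S t u = β₂ b var t (Sc · u) ⊙ ax (R-Sc _ _ _) ⊙ β₂ (pred · v1) var _ u
       ⊙ ap≐ pred (sym≐ (β₂ b var t u))
  where
  b = R · v0 · v1 · lam (lam (pred · v1))

ifz-cong : {t t′ : Tm Γ ι} (u v : Tm Γ ι) → Φ ⊢ t ≐ t′ → Φ ⊢ ifz t u v ≐ ifz t′ u v
ifz-cong {t = t} {t′} u v p = app≈ (cond · t · u) (cond · t′ · u)
  (app≈ (cond · t) (cond · t′) (ap≐ cond p) u) v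

ifzO : {t : Tm Γ ι} (u v : Tm Γ ι) → Φ ⊢ t ≐ O → Φ ⊢ ifz t u v ≐ u
ifzO u v p = ifz-cong u v p
  ⊙ β₃ (R · v2 · v1 · lam (lam v2)) var O u v ⊙ ax (R-O _ _)

ifzS : {t r : Tm Γ ι} (u v : Tm Γ ι) → Φ ⊢ t ≐ Sc · r → Φ ⊢ ifz t u v ≐ v
ifzS {r = r} u v p = ifz-cong u v p
  ⊙ β₃ (R · v2 · v1 · lam (lam v2)) var (Sc · r) u v ⊙ ax (R-Sc _ _ _)
  ⊙ β₂ v2 (var ▹ Sc · r ▹ u ▹ v) _ r

-- Side premises have to be put into `φ` as implications. The conclusion is open, so that `at⟨_⟩`
-- can specialise it.
ind : (φ : Fm (ι ∷ Γ)) → QF φ → [] ⊢ φ [ O ] → φ ∷ [] ⊢ subF sucInst φ → [] ⊢ φ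
ind φ q base step = ⊢≡ (inst-lift-wk φ)
  (∀E (wk⊢ (⊃E (⊃E (ax (qf-ind φ q)) base) (∀I (⊃I step)))) v0)

Nat₁ Nat₂ Nat₃ : Ctx
Nat₁ = ι ∷ []
Nat₂ = ι ∷ Nat₁
Nat₃ = ι ∷ Nat₂

⟪_⟫ : Tm Γ ι → Sub Nat₁ Γ
⟪ t ⟫ = (λ ()) ▹ t

⟪_,_⟫ : Tm Γ ι → Tm Γ ι → Sub Nat₂ Γ
⟪ t , u ⟫ = ⟪ t ⟫ ▹ u

⟪_,_,_⟫ : Tm Γ ι → Tm Γ ι → Tm Γ ι → Sub Nat₃ Γ
⟪ t , u , v ⟫ = ⟪ t , u ⟫ ▹ v

O+ : (t : Tm Γ ι) → Φ ⊢ O ∔ t ≐ t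
O+ t = at⟨ ⟪ t ⟫ ⟩ (ind (O ∔ v0 ≐ v0) atom (+O O) (+S O v0 ⊙ S≐ h0))

S+ : (t u : Tm Γ ι) → Φ ⊢ Sc · t ∔ u ≐ Sc · (t ∔ u)
S+ t u = at⟨ ⟪ t , u ⟫ ⟩ (ind (Sc · v1 ∔ v0 ≐ Sc · (v1 ∔ v0)) atom
  (+O _ ⊙ S≐ (sym≐ (+O _)))
  (+S _ _ ⊙ S≐ (h0 ⊙ sym≐ (+S _ _))))

+comm : (t u : Tm Γ ι) → Φ ⊢ t ∔ u ≐ u ∔ t
+comm t u = at⟨ ⟪ t , u ⟫ ⟩ (ind (v1 ∔ v0 ≐ v0 ∔ v1) atom
  (+O _ ⊙ sym≐ (O+ _))
  (+S _ _ ⊙ S≐ h0 ⊙ sym≐ (S+ _ _)))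

O∨S : (t : Tm Γ ι) → Φ ⊢ t ≐ O ∨̇ t ≐ Sc · (pred · t)
O∨S t = at⟨ ⟪ t ⟫ ⟩ (ind (v0 ≐ O ∨̇ v0 ≐ Sc · (pred · v0)) (or atom atom)
  (∨I₁ refl≐) (∨I₂ (S≐ (sym≐ (predS _)))))

byCases : (t : Tm Γ ι) → (t ≐ O) ∷ Φ ⊢ φ → (t ≐ Sc · (pred · t)) ∷ Φ ⊢ φ → Φ ⊢ φ
byCases t = ∨E (O∨S t)

S∸S : (t u : Tm Γ ι) → Φ ⊢ Sc · t ∸̇ Sc · u ≐ t ∸̇ u
S∸S t u = at⟨ ⟪ t , u ⟫ ⟩ (ind (Sc · v1 ∸̇ Sc · v0 ≐ v1 ∸̇ v0) atom
  (∸S _ _ ⊙ ap≐ pred (∸O _) ⊙ predS _ ⊙ sym≐ (∸O _))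
  (∸S _ _ ⊙ ap≐ pred h0 ⊙ sym≐ (∸S _ _)))

+∸+ : (t u v : Tm Γ ι) → Φ ⊢ (v ∔ t) ∸̇ (v ∔ u) ≐ t ∸̇ u
+∸+ t u v = at⟨ ⟪ t , u , v ⟫ ⟩ (ind ((v0 ∔ v2) ∸̇ (v0 ∔ v1) ≐ v2 ∸̇ v1) atom
  (ap₂≐ monus (O+ _) (O+ _))
  (ap₂≐ monus (S+ _ _) (S+ _ _) ⊙ S∸S _ _ ⊙ h0))

m+n∸m : (t u : Tm Γ ι) → Φ ⊢ (t ∔ u) ∸̇ t ≐ u
m+n∸m t u = ap₂≐ monus refl≐ (sym≐ (+O t)) ⊙ +∸+ u O t ⊙ ∸O u

n∸n : (t : Tm Γ ι) → Φ ⊢ t ∸̇ t ≐ O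
n∸n t = ap₂≐ monus (sym≐ (+O t)) refl≐ ⊙ m+n∸m t O

O∸ : (t : Tm Γ ι) → Φ ⊢ O ∸̇ t ≐ O
O∸ t = at⟨ ⟪ t ⟫ ⟩ (ind (O ∸̇ v0 ≐ O) atom (∸O O) (∸S _ _ ⊙ ap≐ pred h0 ⊙ predO))

-- Totality of the order with the difference as explicit witness, which keeps the formula
-- quantifier-free and thus open to induction on `u`.
≤-total : (t u : Tm Γ ι) → Φ ⊢ u ≐ t ∔ (u ∸̇ t) ∨̇ t ≐ u ∔ (t ∸̇ u)
≤-total t u = at⟨ ⟪ t , u ⟫ ⟩ (ind (v0 ≐ v1 ∔ (v0 ∸̇ v1) ∨̇ v1 ≐ v0 ∔ (v1 ∸̇ v0)) (or atom atom)
  (∨I₂ (sym≐ (∸O _) ⊙ sym≐ (O+ _)))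
  (∨E h0 (∨I₁ (suc-right h0))
    -- If the difference is 0 then `t` equals `u`, and passing to the successor of `u` switches to
    -- the first disjunct.
    (byCases (v1 ∸̇ v0)
      (∨I₁ (suc-right (sym≐ equal ⊙ sym≐ (+O _) ⊙
        ap₂≐ plus refl≐ (sym≐ (ap₂≐ monus (sym≐ equal) refl≐ ⊙ n∸n _)))))
      (∨I₂ (wk∷ h0 ⊙ ap₂≐ plus refl≐ h0 ⊙ +S _ _ ⊙ sym≐ (S+ _ _)
            ⊙ ap₂≐ plus refl≐ (sym≐ (∸S _ _)))))))
  where
  equal : {t u : Tm Γ ι} → (t ∸̇ u ≐ O) ∷ (t ≐ u ∔ (t ∸̇ u)) ∷ Φ ⊢ t ≐ u
  equal = wk∷ h0 ⊙ ap₂≐ plus refl≐ h0 ⊙ +O _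
  suc-right : {t u : Tm Γ ι} → Φ ⊢ u ≐ t ∔ (u ∸̇ t) → Φ ⊢ Sc · u ≐ t ∔ (Sc · u ∸̇ t)
  suc-right p = q ⊙ ap₂≐ plus refl≐ (sym≐ (ap₂≐ monus q refl≐ ⊙ m+n∸m _ _))
    where
    q = S≐ p ⊙ sym≐ (+S _ _)

m+n≡0⇒m≡0 : {t u : Tm Γ ι} → Φ ⊢ t ∔ u ≐ O → Φ ⊢ t ≐ O
m+n≡0⇒m≡0 {t = t} {u} p = byCases t h0
  (S≢O (sym≐ (S+ _ _) ⊙ ap₂≐ plus (sym≐ h0) refl≐ ⊙ wk∷ p))

dist≡0 : {t u : Tm Γ ι} → Φ ⊢ t ≐ u → Φ ⊢ dist t u ≐ O
dist≡0 p = ap₂≐ plus (ap₂≐ monus p refl≐ ⊙ n∸n _) (ap₂≐ monus refl≐ p ⊙ n∸n _) ⊙ +O _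

dist≡0⇒≡ : {t u : Tm Γ ι} → Φ ⊢ dist t u ≐ O → Φ ⊢ t ≐ u
dist≡0⇒≡ {t = t} {u} p = ∨E (≤-total t u)
  (sym≐ (h0 ⊙ ap₂≐ plus refl≐ (wk∷ (m+n≡0⇒m≡0 (+comm _ _ ⊙ p))) ⊙ +O _))
  (h0 ⊙ ap₂≐ plus refl≐ (wk∷ (m+n≡0⇒m≡0 p)) ⊙ +O _)

-- Cantor's pairing

triO : Φ ⊢ tri · O ≐ O
triO = β (R · v0 · O · lam (lam (v1 ∔ Sc · v0))) var O ⊙ ax (R-O _ _)

triS : (t : Tm Γ ι) → Φ ⊢ tri · (Sc · t) ≐ tri · t ∔ Sc · t
triS t = β b var (Sc · t) ⊙ ax (R-Sc _ _ _) ⊙ β₂ (v1 ∔ Sc · v0) var _ t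
       ⊙ ap₂≐ plus (sym≐ (β b var t)) refl≐
  where
  b = R · v0 · O · lam (lam (v1 ∔ Sc · v0))

diagO : Φ ⊢ diag · O ≐ O
diagO = β (R · v0 · O ·
         lam (lam (ifz (tri · (Sc · v1) ∸̇ Sc · v0) (Sc · v1) v1))) var O ⊙ ax (R-O _ _)

diag-step : Tm Γ (ι ⇒ ι ⇒ ι)
diag-step = lam (lam (ifz (tri · (Sc · v1) ∸̇ Sc · v0) (Sc · v1) v1))

diagS : {d : Tm Γ ι} (z : Tm Γ ι) → Φ ⊢ diag · z ≐ d →
        Φ ⊢ diag · (Sc · z) ≐ ifz (tri · (Sc · d) ∸̇ Sc · z) (Sc · d) d
diagS {d = d} z p = β b var (Sc · z) ⊙ ax (R-Sc _ _ _)
      ⊙ app≈ (diag-step · _) (diag-step · d) (ap≐ diag-step (sym≐ (β b var z) ⊙ p)) z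
      ⊙ β₂ (ifz (tri · (Sc · v1) ∸̇ Sc · v0) (Sc · v1) v1) var d z
  where
  b = R · v0 · O · diag-step

-- Induction on `n`: since `tri (s + 1)` is `tri s + s + 1`, the conditional in `diag` does not step
-- up as long as `n ≤ s`, which is what the second premise expresses.
diag-tri+ : (s n : Tm Γ ι) → Φ ⊢ diag · (tri · s) ≐ s → Φ ⊢ s ≐ n ∔ (s ∸̇ n) → Φ ⊢ diag · (tri · s ∔ n) ≐ s
diag-tri+ s n p q = ⊃E (⊃E (at⟨ ⟪ s , n ⟫ ⟩ lemma) p) q
  where
  lemma : [] {A = Fm Nat₂} ⊢ diag · (tri · v1) ≐ v1 ⊃ v1 ≐ v0 ∔ (v1 ∸̇ v0) ⊃ diag · (tri · v1 ∔ v0) ≐ v1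
  lemma = ind _ (imp atom (imp atom atom))
    (⊃I (⊃I (ap≐ diag (+O _) ⊙ wk∷ h0)))
    (⊃I (⊃I (ap≐ diag (+S _ _)
      ⊙ diagS _ (⊃E (⊃E (wk∷ (wk∷ h0)) (wk∷ h0)) (s≡n+S ⊙ ap₂≐ plus refl≐ (sym≐ s∸n)))
      ⊙ ifzS _ _ (ap₂≐ monus (triS _ ⊙ +S _ _) refl≐ ⊙ S∸S _ _ ⊙ +∸+ _ _ _ ⊙ s∸n))))
    where
    s≡n+S = h0 ⊙ S+ _ _ ⊙ sym≐ (+S _ _)
    s∸n = ap₂≐ monus s≡n+S refl≐ ⊙ m+n∸m _ _

-- `tri (s + 1)` is the successor of `tri s + s`, the last number of diagonal `s`; there the
-- conditional in `diag` does step up.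
diag-tri : (s : Tm Γ ι) → Φ ⊢ diag · (tri · s) ≐ s
diag-tri s = at⟨ ⟪ s ⟫ ⟩ (ind (diag · (tri · v0) ≐ v0) atom
  (ap≐ diag triO ⊙ diagO)
  (ap≐ diag (triS _ ⊙ +S _ _)
   ⊙ diagS _ (diag-tri+ v0 v0 h0 (sym≐ (ap₂≐ plus refl≐ (n∸n _) ⊙ +O _)))
   ⊙ ifzO _ _ (ap₂≐ monus (triS _ ⊙ +S _ _) refl≐ ⊙ n∸n _)))

pair-def : (m n : Tm Γ ι) → Φ ⊢ ⟨ m , n ⟩ ≐ tri · (m ∔ n) ∔ n
pair-def m n = β₂ (tri · (v1 ∔ v0) ∔ v0) var m n

diag-pair : (m n : Tm Γ ι) → Φ ⊢ diag · ⟨ m , n ⟩ ≐ m ∔ n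
diag-pair m n = ap≐ diag (pair-def m n) ⊙ diag-tri+ (m ∔ n) n (diag-tri _)
  (+comm m n ⊙ ap₂≐ plus refl≐ (sym≐ (ap₂≐ monus (+comm m n) refl≐ ⊙ m+n∸m n m)))

snd-pair : (m n : Tm Γ ι) → Φ ⊢ snd · ⟨ m , n ⟩ ≐ n
snd-pair m n = β (v0 ∸̇ tri · (diag · v0)) var _
  ⊙ ap₂≐ monus (pair-def m n) (ap≐ tri (diag-pair m n)) ⊙ m+n∸m _ n

fst-pair : (m n : Tm Γ ι) → Φ ⊢ fst · ⟨ m , n ⟩ ≐ m
fst-pair m n = β (diag · v0 ∸̇ snd · v0) var _
  ⊙ ap₂≐ monus (diag-pair m n ⊙ +comm m n) (snd-pair m n) ⊙ m+n∸m n m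

-- Arithmetical comprehension from μ

lam-β : (t : Tm (σ ∷ Γ) τ) → Φ ⊢ lam t ↑ · v0 ≈ t
lam-β t = ⊢≡
  (cong (lam t ↑ · v0 ≈_)
    (trans (subT-cong (λ { (here refl) → refl ; (there x) → refl }) t) (subT-var t)))
  (β t wk v0)

lam-inst : (t : Tm (σ ∷ Γ) τ) (u : Tm Γ σ) → Φ ⊢ lam t · u ≈ subT (inst u) t
lam-inst t u = ⊢≡
  (cong₂ (λ f r → f · u ≈ r) (subT-var (lam t))
    (subT-cong (λ { (here refl) → refl ; (there x) → refl }) t))
  (β t var u)

∃-map : φ ∷ map wkF Φ ⊢ ψ → Φ ⊢ ∃̇ σ φ → Φ ⊢ ∃̇ σ ψ
∃-map {ψ = ψ} q p = ∃E p (∃I v0 (⊢≡ (sym (inst-lift-wk ψ)) q))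

¬∃⇒∀¬ : Φ ⊢ ¬̇ ∃̇ σ φ → map wkF Φ ⊢ ¬̇ φ
¬∃⇒∀¬ {φ = φ} p = ⊃I (⊃E (wk∷ (wk⊢ p)) (∃I v0 (⊢≡ (sym (inst-lift-wk φ)) h0)))

∀-wk : Φ ⊢ ∀̇ σ φ → map wkF Φ ⊢ φ
∀-wk {φ = φ} p = ⊢≡ (inst-lift-wk φ) (∀E (wk⊢ p) v0)

data Arith {Γ : Ctx} : Fm Γ → Set where
  atom : ∀ {t u} → Arith (t ≐ u)
  bot  : Arith ⊥̇
  and  : Arith φ → Arith ψ → Arith (φ ∧̇ ψ)
  or   : Arith φ → Arith ψ → Arith (φ ∨̇ ψ)
  imp  : Arith φ → Arith ψ → Arith (φ ⊃ ψ)
  all  : Arith φ → Arith (∀̇ ι φ)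
  ex   : Arith φ → Arith (∃̇ ι φ)

-- The value of a function at the place proposed by `μ` is 0 exactly when the function has a zero,
-- so one term decides an existential statement.
search : Tm Γ 𝟚 → Tm (ι ∷ Γ) ι → Tm Γ ι
search μ t = lam t · (μ · lam t)

-- The value 0 codes truth.
char : Tm Γ 𝟚 → {φ : Fm Γ} → Arith φ → Tm Γ ι
char μ (atom {t} {u}) = dist t u
char μ bot            = one
char μ (and a b)      = ifz (char μ a) (char μ b) one
char μ (or a b)       = ifz (char μ a) O (char μ b)
char μ (imp a b)      = ifz (char μ a) (char μ b) O
-- The inner conditional vanishes exactly at the counterexamples, so a successful search yields the
-- value for falsity.
char μ (all a)        = ifz (search μ (ifz (char (μ ↑) a) one O)) one O
char μ (ex a)         = search μ (char (μ ↑) a)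

wk-MU : (μ : Tm Γ 𝟚) → Φ ⊢ MU μ → map (wkF {σ = σ}) Φ ⊢ MU (μ ↑)
wk-MU μ p = ⊢≡
  (cong (λ m → ∀̇ 𝟙 (∃̇ ι (v1 · v0 ≐ O) ⊃ v0 · (m · v0) ≐ O)) (subT-lift-↑ wk μ)) (wk⊢ p)

search⁺ : {μ : Tm Γ 𝟚} (t : Tm (ι ∷ Γ) ι) → Φ ⊢ MU μ → Φ ⊢ ∃̇ ι (t ≐ O) → Φ ⊢ search μ t ≐ O
search⁺ {μ = μ} t m p = ⊃E
  (⊢≡ (cong (λ m → ∃̇ ι (lam t ↑ · v0 ≐ O) ⊃ lam t · (m · lam t) ≐ O) (inst-↑ (lam t) μ))
    (∀E m (lam t)))
  (∃-map (lam-β t ⊙ h0) p)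

search⁻ : {μ : Tm Γ 𝟚} (t : Tm (ι ∷ Γ) ι) → Φ ⊢ search μ t ≐ O → Φ ⊢ (t ≐ O) [ μ · lam t ]
search⁻ t p = sym≐ (lam-inst t _) ⊙ p

-- The two directions are proved together because an implication exchanges them for its premise.
char⁺ : {μ : Tm Γ 𝟚} (a : Arith φ) → Φ ⊢ MU μ → Φ ⊢ φ → Φ ⊢ char μ a ≐ O
char⁻ : {μ : Tm Γ 𝟚} (a : Arith φ) → Φ ⊢ MU μ → Φ ⊢ char μ a ≐ O → Φ ⊢ φ

char⁺ atom m p = dist≡0 p
char⁺ bot m p = ⊥E p
char⁺ (and a b) m p = ifzO _ _ (char⁺ a m (∧E₁ p)) ⊙ char⁺ b m (∧E₂ p)
char⁺ {μ = μ} (or a b) m p = ∨E p (ifzO _ _ (char⁺ a (wk∷ m) h0))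
  (byCases (char μ a) (ifzO _ _ h0) (ifzS _ _ h0 ⊙ wk∷ (char⁺ b (wk∷ m) h0)))
char⁺ {μ = μ} (imp a b) m p = byCases (char μ a)
  (ifzO _ _ h0 ⊙ char⁺ b (wk∷ m) (⊃E (wk∷ p) (char⁻ a (wk∷ m) h0)))
  (ifzS _ _ h0)
char⁺ {μ = μ} (all a) m p = byCases (search μ t)
  -- The witness is packed and unpacked again to turn it into a fresh variable, over which the
  -- induction hypothesis is stated.
  (∃E (∃I {φ = t ≐ O} _ (search⁻ t h0))
    (S≢O (sym≐ (ifzO _ _ (char⁺ a (wk∷ (wk∷ (wk-MU μ m))) (wk∷ (wk∷ (∀-wk p))))) ⊙ h0)))
  (ifzS _ _ h0)
  where
  t = ifz (char (μ ↑) a) one O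
char⁺ {μ = μ} (ex a) m p = search⁺ _ m (∃-map (char⁺ a (wk∷ (wk-MU μ m)) h0) p)

char⁻ atom m p = dist≡0⇒≡ p
char⁻ bot m p = S≢O p
char⁻ {μ = μ} (and a b) m p = byCases (char μ a)
  (∧I (char⁻ a (wk∷ m) h0) (char⁻ b (wk∷ m) (sym≐ (ifzO _ _ h0) ⊙ wk∷ p)))
  (S≢O (sym≐ (ifzS _ _ h0) ⊙ wk∷ p))
char⁻ {μ = μ} (or a b) m p = byCases (char μ a)
  (∨I₁ (char⁻ a (wk∷ m) h0))
  (∨I₂ (char⁻ b (wk∷ m) (sym≐ (ifzS _ _ h0) ⊙ wk∷ p)))
char⁻ (imp a b) m p = ⊃I (char⁻ b (wk∷ m) (sym≐ (ifzO _ _ (char⁺ a (wk∷ m) h0)) ⊙ wk∷ p))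
char⁻ {Φ = Φ} {μ = μ} (all {φ = φ} a) m p = ∀I (byCases (char (μ ↑) a)
  (char⁻ a (wk∷ (wk-MU μ m)) h0)
  (⊥E (⊃E (wk∷ (¬∃⇒∀¬ none)) (ifzS _ _ h0))))
  where
  none : Φ ⊢ ¬̇ ∃̇ ι (ifz (char (μ ↑) a) one O ≐ O)
  none = ⊃I (S≢O (sym≐ (ifzO _ _ (search⁺ _ (wk∷ m) h0)) ⊙ wk∷ p))
char⁻ {μ = μ} (ex a) m p = ∃-map (char⁻ a (wk∷ (wk-MU μ m)) h0) (∃I _ (search⁻ (char (μ ↑) a) p))

pick : Tm Γ 𝟚 → {φ : Fm (ι ∷ Γ)} → Arith φ → Tm Γ ι
pick μ a = μ · lam (char (μ ↑) a)

pick-spec : {μ : Tm Γ 𝟚} (a : Arith φ) → Φ ⊢ MU μ → Φ ⊢ ∃̇ ι φ → Φ ⊢ φ [ pick μ a ]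
pick-spec {φ = φ} {Φ = Φ} {μ} a m p = ⊃E (∀E (∀I (⊃I (char⁻ a (wk∷ (wk-MU μ m)) h0))) (pick μ a))
  (search⁻ (char (μ ↑) a) (search⁺ _ m (∃-map (char⁺ a (wk∷ (wk-MU μ m)) h0) p)))

choice : Tm Γ 𝟚 → {φ : Fm (ι ∷ σ ∷ Γ)} → Arith φ → Tm Γ (σ ⇒ ι)
choice μ a = lam (pick (μ ↑) a)

-- The chosen value enters only through an equation with a bound variable, and `φ` stays
-- uninstantiated. In this form the choice term can be replaced by a variable in later derivations.
choice-spec : (μ : Tm Γ 𝟚) {φ : Fm (ι ∷ σ ∷ Γ)} (a : Arith φ) → Φ ⊢ MU μ →
              Φ ⊢ ∀̇ σ (∃̇ ι φ ⊃ ∃̇ ι (choice μ a ↑ ↑ · v1 ≐ v0 ∧̇ φ))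
choice-spec μ {φ} a m = ∀I (⊃I (∃I e (∧I
  (⊢≡ (cong (λ c → c · v0 ≐ e) (sym (inst-↑ e (choice μ a ↑)))) (lam-β e))
  (pick-spec a (wk∷ (wk-MU μ m)) h0))))
  where
  e = pick (μ ↑) a

charFun : Tm Γ 𝟚 → {φ : Fm (ι ∷ Γ)} → Arith φ → Tm Γ 𝟙
charFun μ a = lam (char (μ ↑) a)

charFun-spec : (μ : Tm Γ 𝟚) {φ : Fm (ι ∷ Γ)} (a : Arith φ) → Φ ⊢ MU μ →
               Φ ⊢ ∀̇ ι (φ ⇔̇ charFun μ a ↑ · v0 ≐ O)
charFun-spec μ a m = ∀I (∧I
  (⊃I (lam-β (char (μ ↑) a) ⊙ char⁺ a (wk∷ (wk-MU μ m)) h0))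
  (⊃I (char⁻ a (wk∷ (wk-MU μ m)) (sym≐ (lam-β (char (μ ↑) a)) ⊙ h0))))

pick-∃ : (μ : Tm Γ 𝟚) {φ : Fm (ι ∷ Γ)} (a : Arith φ) → Φ ⊢ MU μ →
         Φ ⊢ ∃̇ ι φ ⊃ ∃̇ ι (pick μ a ↑ ≐ v0 ∧̇ φ)
pick-∃ μ a m = ⊃I (∃I (pick μ a) (∧I
  (⊢≡ (cong (_≐ pick μ a) (sym (inst-↑ (pick μ a) (pick μ a)))) refl≐)
  (pick-spec a (wk∷ m) h0)))

-- Comparing candidate hierarchies

v6 : ∀ {a b c d e f g} → Tm (a ∷ b ∷ c ∷ d ∷ e ∷ f ∷ g ∷ Γ) g
v6 = v5 ↑

v7 : ∀ {a b c d e f g h} → Tm (a ∷ b ∷ c ∷ d ∷ e ∷ f ∷ g ∷ h ∷ Γ) h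
v7 = v6 ↑

v8 : ∀ {a b c d e f g h i} → Tm (a ∷ b ∷ c ∷ d ∷ e ∷ f ∷ g ∷ h ∷ i ∷ Γ) i
v8 = v7 ↑

h1 : ∀ {α₀ α₁ : Fm Γ} → α₀ ∷ α₁ ∷ Φ ⊢ α₁
h1 = wk∷ h0

h2 : ∀ {α₀ α₁ α₂ : Fm Γ} → α₀ ∷ α₁ ∷ α₂ ∷ Φ ⊢ α₂
h2 = wk∷ h1

h3 : ∀ {α₀ α₁ α₂ α₃ : Fm Γ} → α₀ ∷ α₁ ∷ α₂ ∷ α₃ ∷ Φ ⊢ α₃
h3 = wk∷ h2

h4 : ∀ {α₀ α₁ α₂ α₃ α₄ : Fm Γ} → α₀ ∷ α₁ ∷ α₂ ∷ α₃ ∷ α₄ ∷ Φ ⊢ α₄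
h4 = wk∷ h3

h5 : ∀ {α₀ α₁ α₂ α₃ α₄ α₅ : Fm Γ} → α₀ ∷ α₁ ∷ α₂ ∷ α₃ ∷ α₄ ∷ α₅ ∷ Φ ⊢ α₅
h5 = wk∷ h4

h6 : ∀ {α₀ α₁ α₂ α₃ α₄ α₅ α₆ : Fm Γ} → α₀ ∷ α₁ ∷ α₂ ∷ α₃ ∷ α₄ ∷ α₅ ∷ α₆ ∷ Φ ⊢ α₆
h6 = wk∷ h5

h7 : ∀ {α₀ α₁ α₂ α₃ α₄ α₅ α₆ α₇ : Fm Γ} →
     α₀ ∷ α₁ ∷ α₂ ∷ α₃ ∷ α₄ ∷ α₅ ∷ α₆ ∷ α₇ ∷ Φ ⊢ α₇
h7 = wk∷ h6

h8 : ∀ {α₀ α₁ α₂ α₃ α₄ α₅ α₆ α₇ α₈ : Fm Γ} →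
     α₀ ∷ α₁ ∷ α₂ ∷ α₃ ∷ α₄ ∷ α₅ ∷ α₆ ∷ α₇ ∷ α₈ ∷ Φ ⊢ α₈
h8 = wk∷ h7

infixl 5 _●_

_●_ : Φ ⊢ φ ⊃ ψ → Φ ⊢ φ → Φ ⊢ ψ
_●_ = ⊃E

ok : Tm Γ (𝟙 ⇒ 𝟙) → Tm Γ 𝟙 → Tm Γ ι → Fm Γ
ok J Z p = Z · p ≐ J · Z · p

-- `lost` excludes minimal errors everywhere, not only below `p`, so that this conjunct passes
-- unchanged to any other wrong place.
okBelow minBad lost : Tm Γ (𝟙 ⇒ 𝟙) → Tm Γ (ι ⇒ ι ⇒ ι) → Tm Γ 𝟙 → Tm Γ ι → Fm Γ
okBelow J L Z p = ∀̇ ι (L ↑ · v0 · p ↑ ≐ O ⊃ ok (J ↑) (Z ↑) v0)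
minBad J L Z p = ¬̇ ok J Z p ∧̇ okBelow J L Z p
lost J L Z p = ¬̇ ok J Z p ∧̇ ∀̇ ι (¬̇ minBad (J ↑) (L ↑) (Z ↑) v0)

clash : Tm Γ (𝟙 ⇒ 𝟙) → Tm Γ (ι ⇒ ι ⇒ ι) → Tm Γ 𝟙 → Tm Γ 𝟙 → Tm Γ ι → Fm Γ
clash J L Z Z′ p =
  okBelow J L Z p ∧̇ ok J Z p ∧̇ okBelow J L Z′ p ∧̇ ok J Z′ p ∧̇ ¬̇ (Z · p ≐ Z′ · p)

-- The indices range over all numbers. When `V` lists a finite sequence, the zero functions beyond
-- its end count as further candidates.
Bad : Tm Γ (𝟙 ⇒ 𝟙) → Tm Γ (ι ⇒ ι ⇒ ι) → Tm Γ (ι ⇒ 𝟙) → Tm Γ ι → Fm Γ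
Bad J L V p =
    ∃̇ ι (lost (J ↑) (L ↑) (V ↑ · v0) (p ↑))
  ∨̇ ∃̇ ι (∃̇ ι (clash (J ↑ ↑) (L ↑ ↑) (V ↑ ↑ · v1) (V ↑ ↑ · v0) (p ↑ ↑)))

Trans : Tm Γ (ι ⇒ ι ⇒ ι) → Fm Γ
Trans L = ∀̇ ι (∀̇ ι (∀̇ ι
  (L ↑ ↑ ↑ · v2 · v1 ≐ O ⊃ L ↑ ↑ ↑ · v1 · v0 ≐ O ⊃ L ↑ ↑ ↑ · v2 · v0 ≐ O)))

Det : Tm Γ (𝟙 ⇒ 𝟙) → Tm Γ (ι ⇒ ι ⇒ ι) → Fm Γ
Det J L = ∀̇ 𝟙 (∀̇ 𝟙 (∀̇ ι
  (∀̇ ι (L ↑ ↑ ↑ ↑ · v0 · v1 ≐ O ⊃ v3 · v0 ≐ v2 · v0) ⊃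
   J ↑ ↑ ↑ · v2 · v0 ≐ J ↑ ↑ ↑ · v1 · v0)))

Rel Jmp Seqs : Ty
Rel = ι ⇒ ι ⇒ ι
Jmp = 𝟙 ⇒ 𝟙
Seqs = ι ⇒ 𝟙

okBelow-trans : [] {A = Fm (ι ∷ ι ∷ 𝟙 ∷ Rel ∷ Jmp ∷ [])} ⊢
  Trans v3 ⊃ okBelow v4 v3 v2 v1 ⊃ v3 · v0 · v1 ≐ O ⊃ okBelow v4 v3 v2 v0
okBelow-trans = ⊃I (⊃I (⊃I (∀I (⊃I
  (∀E h2 v0 ● (∀E (∀E (∀E h3 v0) v1) v2 ● h0 ● h1))))))

-- At each `q` below `p` both functions are right, and by transitivity also below `q`; a
-- disagreement at `q` would therefore be a clash. So they coincide below `p`, and `Det` applies.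
agree : [] {A = Fm (ι ∷ 𝟙 ∷ 𝟙 ∷ Rel ∷ Jmp ∷ [])} ⊢
  Trans v3 ⊃ Det v4 v3 ⊃ okBelow v4 v3 v2 v0 ⊃ okBelow v4 v3 v1 v0 ⊃
  ∀̇ ι (v4 · v0 · v1 ≐ O ⊃ ¬̇ clash v5 v4 v3 v2 v0) ⊃ v4 · v2 · v0 ≐ v4 · v1 · v0
agree = ⊃I (⊃I (⊃I (⊃I (⊃I (∀E (∀E (∀E h3 v2) v1) v0 ● ∀I (⊃I (raa
  (∀E h2 v0 ● h1 ●
    ∧I (at⟨ (λ ()) ▹ v5 ▹ v4 ▹ v3 ▹ v1 ▹ v0 ⟩ okBelow-trans ● h6 ● h4 ● h1)
    (∧I (∀E h4 v0 ● h1)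
    (∧I (at⟨ (λ ()) ▹ v5 ▹ v4 ▹ v2 ▹ v1 ▹ v0 ⟩ okBelow-trans ● h6 ● h3 ● h1)
    (∧I (∀E h3 v0 ● h1) h0)))))))))))

-- A lost place is not a minimal error, so there is a wrong place below it, which is lost as well.
-- If there were no bad place below a clash, `agree` would give both functions the same jump value,
-- hence the same value, at the clash.
progress : [] {A = Fm (ι ∷ Seqs ∷ Rel ∷ Jmp ∷ [])} ⊢
  Trans v2 ⊃ Det v3 v2 ⊃ Bad v3 v2 v1 v0 ⊃ ∃̇ ι (Bad v4 v3 v2 v0 ∧̇ v3 · v0 · v1 ≐ O)
progress = ⊃I (⊃I (⊃I (∨E h0
  (∃E h0 (raa (∀E (∧E₂ h1) v1 ● ∧I (∧E₁ h1)
    (∀I (⊃I (raa (h2 ● ∃I v0 (∧I (∨I₁ (∃I v1 (∧I h0 (∧E₂ h3)))) h1))))))))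
  (∃E h0 (∃E h0 (raa (∧E₂ (∧E₂ (∧E₂ (∧E₂ h1))) ●
    (∧E₁ (∧E₂ h1) ⊙
     (at⟨ (λ ()) ▹ v5 ▹ v4 ▹ v3 · v1 ▹ v3 · v0 ▹ v2 ⟩ agree
       ● h6 ● h5 ● ∧E₁ h1 ● ∧E₁ (∧E₂ (∧E₂ h1))
       ● ∀I (⊃I (⊃I (h2 ● ∃I v0 (∧I (∨I₂ (∃I v2 (∃I v1 h0))) h1))))) ⊙
     sym≐ (∧E₁ (∧E₂ (∧E₂ (∧E₂ h1))))))))))))

-- Descending sequences through a set without minimal elements

descent-step : [] {A = Fm (ι ∷ 𝟙 ∷ 𝟙 ∷ 𝟙 ∷ Rel ∷ [])} ⊢
  (∃̇ ι (v4 · v0 ≐ O ∧̇ v5 · v0 · (v2 · v1) ≐ O) ⊃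
   ∃̇ ι (v3 · (v2 · v1) ≐ v0 ∧̇ v4 · v0 ≐ O ∧̇ v5 · v0 · (v2 · v1) ≐ O)) ⊃
  v1 · (Sc · v0) ≐ v2 · (v1 · v0) ⊃
  (v3 · (v1 · v0) ≐ O ⊃ ∃̇ ι (v4 · v0 ≐ O ∧̇ v5 · v0 · (v2 · v1) ≐ O)) ⊃
  v3 · (v1 · v0) ≐ O ⊃
  v3 · (v1 · (Sc · v0)) ≐ O ∧̇ v4 · (v1 · (Sc · v0)) · (v1 · v0) ≐ O
descent-step = ⊃I (⊃I (⊃I (⊃I (∃E (h3 ● (h1 ● h0))
  (∧I (ap≐ v4 (h3 ⊙ ∧E₁ h0) ⊙ ∧E₁ (∧E₂ h0))
      (ap₂≐ v5 (h3 ⊙ ∧E₁ h0) refl≐ ⊙ ∧E₂ (∧E₂ h0)))))))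

-- A zero of `v3` makes `v2` a zero too, and iterating `v1` from there never leaves the zero set
-- while going down in `v4`.
descent : [] {A = Fm (𝟙 ∷ 𝟙 ∷ ι ∷ 𝟙 ∷ Rel ∷ [])} ⊢
  (∃̇ ι (v4 · v0 ≐ O) ⊃ ∃̇ ι (v3 ≐ v0 ∧̇ v4 · v0 ≐ O)) ⊃
  ∀̇ ι (∃̇ ι (v5 · v0 ≐ O ∧̇ v6 · v0 · v1 ≐ O) ⊃
        ∃̇ ι (v3 · v1 ≐ v0 ∧̇ v5 · v0 ≐ O ∧̇ v6 · v0 · v1 ≐ O)) ⊃
  v0 · O ≐ v2 ⊃
  ∀̇ ι (v1 · (Sc · v0) ≐ v2 · (v1 · v0)) ⊃
  ∀̇ ι (v4 · v0 ≐ O ⊃ ∃̇ ι (v5 · v0 ≐ O ∧̇ v6 · v0 · v1 ≐ O)) ⊃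
  ¬̇ ∀̇ ι (v5 · (v1 · (Sc · v0)) · (v1 · v0) ≐ O) ⊃
  ∀̇ ι (¬̇ (v4 · v0 ≐ O))
descent = ⊃I (⊃I (⊃I (⊃I (⊃I (⊃I (∀I (⊃I (
  ⊃I (h2 ● ∀I (∧E₂ (next h3 h4 h6 ● ∀E h0 v0)))
  -- Because the set is given by its characteristic function, membership is an equation, as
  -- quantifier-free induction requires.
  ● (ax (qf-ind (v5 · (v2 · v0) ≐ O) atom)
     ● ∃E (h6 ● ∃I v0 h0) (ap≐ v5 (h5 ⊙ ∧E₁ h0) ⊙ ∧E₂ h0)
     ● ∀I (⊃I (∧E₁ (next h3 h4 h6 ● h0))))))))))))
  where
  next : {Φ : List (Fm (ι ∷ ι ∷ 𝟙 ∷ 𝟙 ∷ ι ∷ 𝟙 ∷ Rel ∷ []))} →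
    Φ ⊢ ∀̇ ι (v6 · v0 ≐ O ⊃ ∃̇ ι (v7 · v0 ≐ O ∧̇ v8 · v0 · v1 ≐ O)) →
    Φ ⊢ ∀̇ ι (v3 · (Sc · v0) ≐ v4 · (v3 · v0)) →
    Φ ⊢ ∀̇ ι (∃̇ ι (v7 · v0 ≐ O ∧̇ v8 · v0 · v1 ≐ O) ⊃
        ∃̇ ι (v5 · v1 ≐ v0 ∧̇ v7 · v0 ≐ O ∧̇ v8 · v0 · v1 ≐ O)) →
    Φ ⊢ v5 · (v2 · v0) ≐ O ⊃
        v5 · (v2 · (Sc · v0)) ≐ O ∧̇ v6 · (v2 · (Sc · v0)) · (v2 · v0) ≐ O
  next p q r = at⟨ (λ ()) ▹ v6 ▹ v5 ▹ v3 ▹ v2 ▹ v0 ⟩ descent-step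
    ● ∀E r (v2 · v0) ● ∀E q v0 ● ∀E p (v2 · v0)

-- Of the initial segment supplied by the fan functional only its last place is used, the minimal
-- error detected by `G`: `W` was built to disagree with the candidate there.
covered : [] {A = Fm (𝟙 ∷ 𝟚 ∷ Seqs ∷ Rel ∷ Jmp ∷ [])} ⊢
  Trans v3 ⊃ Det v4 v3 ⊃ ∀̇ ι (¬̇ Bad v5 v4 v3 v0) ⊃
  ∀̇ 𝟙 (∃̇ ι (minBad v6 v5 v1 v0) ⊃ ∃̇ ι (v3 · v1 ≐ Sc · v0 ∧̇ minBad v6 v5 v1 v0)) ⊃
  ∀̇ ι (∃̇ ι (okBelow v6 v5 (v4 · v0) v1) ⊃
        ∃̇ ι (v2 · v1 ≐ v6 · (v4 · v0) · v1 ∧̇ okBelow v6 v5 (v4 · v0) v1)) ⊃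
  ∀̇ ι (∀̇ ι (v3 · (v4 · v1) ≐ Sc · v0 ⊃ v2 · v0 ≐ v4 · v1 · v0) ⊃ ∀̇ ι (ok v6 (v4 · v1) v0))
covered = ⊃I (⊃I (⊃I (⊃I (⊃I (∀I (⊃I (∀I (raa
  -- A candidate that is wrong without having a minimal error would be lost, hence bad.
  (∃E (∀E h3 (v4 · v1) ● raa (∀E h5 v0 ● ∨I₁ (∃I v1 (∧I h1 (∀I (⊃I (h1 ● ∃I v0 h0)))))))
  -- The candidate itself is right below its minimal error, so the index used by `W` at this place
  -- is a proper choice, possibly of another candidate.
  (∃E (∀E h3 v0 ● ∃I v2 (∧E₂ (∧E₂ h0)))
  (∧E₁ (∧E₂ h1) ●
    (sym≐ (∀E h3 v1 ● ∧E₁ h1) ⊙ ∧E₁ h0 ⊙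
     (at⟨ (λ ()) ▹ v8 ▹ v7 ▹ v6 · v0 ▹ v6 · v3 ▹ v1 ⟩ agree
       ● h8 ● h7 ● ∧E₂ h0 ● ∧E₂ (∧E₂ h1)
       ● ∀I (⊃I (⊃I (∀E h8 v0 ● ∨I₂ (∃I v1 (∃I v4 h0))))))))))))))))))

-- The iterated jump

lam-β₂ : (t : Tm (ρ ∷ σ ∷ Γ) τ) → Φ ⊢ lam (lam t) ↑ ↑ · v1 · v0 ≈ t
lam-β₂ t = trans≈ (lam (lam t) ↑ ↑ · v1 · v0) (lam t ↑ · v0) t
  (app≈ (lam (lam t) ↑ ↑ · v1) (lam t ↑)
    (⊢≡ (subF-eq wk _ (lam (lam t) ↑ · v0) (lam t)) (at⟨ wk ⟩ (lam-β (lam t)))) v0)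
  (lam-β t)

lam-β₃ : (t : Tm (υ ∷ ρ ∷ σ ∷ Γ) τ) → Φ ⊢ lam (lam (lam t)) ↑ ↑ ↑ · v2 · v1 · v0 ≈ t
lam-β₃ t = trans≈ (lam (lam (lam t)) ↑ ↑ ↑ · v2 · v1 · v0) (lam t ↑ · v0) t
  (app≈ (lam (lam (lam t)) ↑ ↑ ↑ · v2 · v1) (lam t ↑)
    (⊢≡ (subF-eq wk _ (lam (lam (lam t)) ↑ ↑ · v1 · v0) (lam t)) (at⟨ wk ⟩ (lam-β₂ (lam t)))) v0)
  (lam-β t)

-- Substitution does not compute on an arbitrary formula, so the three instantiations are merged
-- into one here.
∀E₃ : {φ : Fm (υ ∷ ρ ∷ σ ∷ Γ)} → Φ ⊢ ∀̇ σ (∀̇ ρ (∀̇ υ φ)) →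
      (t : Tm Γ σ) (u : Tm Γ ρ) (v : Tm Γ υ) → Φ ⊢ subF (var ▹ t ▹ u ▹ v) φ
∀E₃ {φ = φ} p t u v = ⊢≡
  (trans (cong (subF (inst v)) (subF-∘-cong _ _ (λ x → refl) φ))
    (subF-∘-cong _ _
      (λ { (here refl) → refl
         ; (there (here refl)) → inst-↑ v u
         ; (there (there (here refl))) → trans (cong (subT (inst v)) (subT-lift-↑ (inst u) (t ↑)))
                                          (trans (inst-↑ v _) (inst-↑ u t))
         ; (there (there (there x))) → refl }) φ))
  (∀E (∀E (∀E p t) u) v)

subF-inst₂ : (s : Sub Γ Δ) (t : Tm Γ σ) (u : Tm Γ τ) (θ : Fm (σ ∷ τ ∷ [])) →
             subF s (subF (inst₂ t u) θ) ≡ subF (inst₂ (subT s t) (subT s u)) θ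
subF-inst₂ s t u = subF-∘-cong s (inst₂ t u) λ { (here refl) → refl ; (there (here refl)) → refl }

-- The bound by 1 serves twice: it makes `W` admissible for `SFF`, and it makes every fixed point a
-- set.
JumpAt : Tm Γ ι → Tm Γ 𝟙 → Tm Γ ι → Fm Γ → Fm Γ
JumpAt t X i φ = (t ≐ one ⇔̇ i ∈field X ∧̇ φ) ∧̇ t ≤̇ one

JumpAt-cong : {t t′ : Tm Γ ι} {X X′ : Tm Γ 𝟙} {i : Tm Γ ι} {φ φ′ : Fm Γ} →
              t ≡ t′ → X ≡ X′ → φ ≡ φ′ → JumpAt t X i φ ≡ JumpAt t′ X′ i φ′
JumpAt-cong refl refl refl = refl

JumpSpec : Fm (ι ∷ 𝟙 ∷ []) → Tm Γ (𝟙 ⇒ ι ⇒ ι ⇒ ι) → Tm Γ 𝟙 → Fm Γ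
JumpSpec θ j X =
  ∀̇ 𝟙 (∀̇ ι (∀̇ ι (JumpAt (j ↑ ↑ ↑ · v2 · v1 · v0) (X ↑ ↑ ↑) v0 (subF (inst₂ v1 v2) θ))))

jump-at : ∀ {θ} (j : Tm Γ (𝟙 ⇒ ι ⇒ ι ⇒ ι)) (X : Tm Γ 𝟙) → Φ ⊢ JumpSpec θ j X →
          (B : Tm Γ 𝟙) (n i : Tm Γ ι) → Φ ⊢ JumpAt (j · B · n · i) X i (subF (inst₂ n B) θ)
jump-at {θ = θ} j X p B n i = ⊢≡
  (JumpAt-cong (cong (λ j → j · B · n · i) (drop₃ j)) (drop₃ X) (subF-inst₂ _ v1 v2 θ))
  (∀E₃ p B n i)
  where
  drop₃ : (t : Tm _ τ) → subT (var ▹ B ▹ n ▹ i) (t ↑ ↑ ↑) ≡ t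
  drop₃ t = trans (subT-▹-↑ _ i (t ↑ ↑)) (trans (subT-▹-↑ _ n (t ↑)) (trans (subT-▹-↑ _ B t) (subT-var t)))

wk-JumpSpec : ∀ {θ} (j : Tm Γ (𝟙 ⇒ ι ⇒ ι ⇒ ι)) (X : Tm Γ 𝟙) →
              Φ ⊢ JumpSpec θ j X → map (wkF {σ = σ}) Φ ⊢ JumpSpec θ (j ↑) (X ↑)
wk-JumpSpec {Γ = Γ} {σ = σ} {θ = θ} j X p = ⊢≡
  (cong (λ φ → ∀̇ 𝟙 (∀̇ ι (∀̇ ι φ)))
    (JumpAt-cong {i = v0} (cong (λ j → j · v2 · v1 · v0) (lift₃ j)) (lift₃ X)
      (subF-inst₂ (lift (lift (lift wk))) v1 v2 θ)))
  (wk⊢ p)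
  where
  lift₃ : (t : Tm Γ τ) →
    subT (lift {σ = ι} (lift {σ = ι} (lift {σ = 𝟙} (wk {σ = σ})))) (t ↑ ↑ ↑) ≡ t ↑ ↑ ↑ ↑
  lift₃ t = trans (subT-lift-↑ _ (t ↑ ↑)) (cong _↑ (trans (subT-lift-↑ _ (t ↑)) (cong _↑ (subT-lift-↑ _ t))))

-- b stands for below · X.
IterSpec : Tm Γ Jmp → Tm Γ (𝟙 ⇒ ι ⇒ ι ⇒ ι) → Tm Γ (𝟙 ⇒ ι ⇒ 𝟙) → Fm Γ
IterSpec J j b = ∀̇ 𝟙 (∀̇ ι
  (J ↑ ↑ · v1 · v0 ≐ j ↑ ↑ · (b ↑ ↑ · v1 · (snd · v0)) · (fst · v0) · (snd · v0)))

OrderSpec : Tm Γ Rel → Tm Γ 𝟙 → Fm Γ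
OrderSpec L X = ∀̇ ι (∀̇ ι (snd · v1 <⟨ X ↑ ↑ ⟩ snd · v0 ⇔̇ L ↑ ↑ · v1 · v0 ≐ O))

ifz≐one : {t : Tm Γ ι} → Φ ⊢ (ifz t one O ≐ one ⇔̇ t ≐ O) ∧̇ ifz t one O ≤̇ one
ifz≐one {t = t} = ∧I
  (∧I (⊃I (byCases t h0 (S≢O (sym≐ h1 ⊙ ifzS _ _ h0)))) (⊃I (ifzO _ _ h0)))
  (byCases t (ap₂≐ monus (ifzO _ _ h0) refl≐ ⊙ n∸n _)
             (ap₂≐ monus (ifzS _ _ h0) refl≐ ⊙ O∸ _))

charFun₂ : Tm Γ 𝟚 → {φ : Fm (ρ ∷ σ ∷ Γ)} → Arith φ → Tm Γ (σ ⇒ ρ ⇒ ι)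
charFun₂ μ a = lam (lam (char (μ ↑ ↑) a))

charFun₂-spec : (μ : Tm Γ 𝟚) {φ : Fm (ρ ∷ σ ∷ Γ)} (a : Arith φ) → Φ ⊢ MU μ →
                Φ ⊢ ∀̇ σ (∀̇ ρ (φ ⇔̇ charFun₂ μ a ↑ ↑ · v1 · v0 ≐ O))
charFun₂-spec μ a m = ∀I (∀I (∧I
  (⊃I (lam-β₂ (char (μ ↑ ↑) a) ⊙ char⁺ a (wk∷ m′) h0))
  (⊃I (char⁻ a (wk∷ m′) (sym≐ (lam-β₂ (char (μ ↑ ↑) a)) ⊙ h0)))))
  where
  m′ = wk-MU (μ ↑) (wk-MU μ m)

indicator : Tm Γ 𝟚 → {φ : Fm (υ ∷ ρ ∷ σ ∷ Γ)} → Arith φ → Tm Γ (σ ⇒ ρ ⇒ υ ⇒ ι)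
indicator μ a = lam (lam (lam (ifz (char (μ ↑ ↑ ↑) a) one O)))

indicator-spec : (μ : Tm Γ 𝟚) {φ : Fm (υ ∷ ρ ∷ σ ∷ Γ)} (a : Arith φ) → Φ ⊢ MU μ →
  Φ ⊢ ∀̇ σ (∀̇ ρ (∀̇ υ ((indicator μ a ↑ ↑ ↑ · v2 · v1 · v0 ≐ one ⇔̇ φ)
                       ∧̇ indicator μ a ↑ ↑ ↑ · v2 · v1 · v0 ≤̇ one)))
indicator-spec μ a m = ∀I (∀I (∀I (∧I
  (∧I (⊃I (char⁻ a (wk∷ m′) (∧E₁ (∧E₁ ifz≐one) ● (sym≐ (lam-β₃ t) ⊙ h0))))
      (⊃I (lam-β₃ t ⊙ (∧E₂ (∧E₁ ifz≐one) ● char⁺ a (wk∷ m′) h0))))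
  (ap₂≐ monus (lam-β₃ t) refl≐ ⊙ ∧E₂ ifz≐one))))
  where
  t = ifz (char (μ ↑ ↑ ↑) a) one O
  m′ = wk-MU (μ ↑ ↑) (wk-MU (μ ↑) (wk-MU μ m))

jumpArith : (X : Tm Γ 𝟙) →
            Arith {ι ∷ ι ∷ 𝟙 ∷ Γ} (v0 ∈field X ↑ ↑ ↑ ∧̇ subF (inst₂ v1 v2) θ₀)
jumpArith X = and atom (ex atom)

abstract

  jump : Tm Γ 𝟚 → Tm Γ 𝟙 → Tm Γ (𝟙 ⇒ ι ⇒ ι ⇒ ι)
  jump μ X = indicator μ (jumpArith X)

  jump-spec : (μ : Tm Γ 𝟚) (X : Tm Γ 𝟙) → Φ ⊢ MU μ → Φ ⊢ JumpSpec θ₀ (jump μ X) X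
  jump-spec μ X = indicator-spec μ (jumpArith X)

abstract

  iter : Tm Γ (𝟙 ⇒ ι ⇒ ι ⇒ ι) → Tm Γ (𝟙 ⇒ ι ⇒ 𝟙) → Tm Γ Jmp
  iter j b = lam (lam (j ↑ ↑ · (b ↑ ↑ · v1 · (snd · v0)) · (fst · v0) · (snd · v0)))

  iter-spec : (j : Tm Γ (𝟙 ⇒ ι ⇒ ι ⇒ ι)) (b : Tm Γ (𝟙 ⇒ ι ⇒ 𝟙)) → Φ ⊢ IterSpec (iter j b) j b
  iter-spec j b = ∀I (∀I
    (lam-β₂ (j ↑ ↑ · (b ↑ ↑ · v1 · (snd · v0)) · (fst · v0) · (snd · v0))))

orderArith : (X : Tm Γ 𝟙) → Arith {ι ∷ ι ∷ Γ} (snd · v1 <⟨ X ↑ ↑ ⟩ snd · v0)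
orderArith X = and atom (imp atom bot)

abstract

  order : Tm Γ 𝟚 → Tm Γ 𝟙 → Tm Γ Rel
  order μ X = charFun₂ μ (orderArith X)

  order-spec : (μ : Tm Γ 𝟚) (X : Tm Γ 𝟙) → Φ ⊢ MU μ → Φ ⊢ OrderSpec (order μ X) X
  order-spec μ X = charFun₂-spec μ (orderArith X)

order-trans : [] {A = Fm (Rel ∷ 𝟙 ∷ [])} ⊢ LO v1 ⊃ OrderSpec v0 v1 ⊃ Trans v0
order-trans = ⊃I (⊃I (∀I (∀I (∀I (⊃I (⊃I
  (∧E₁ (∀E (∀E h2 v2) v0) ● ∧I
    (∀E (∀E (∀E (∧E₁ (∧E₂ h3)) (snd · v2)) (snd · v1)) (snd · v0)
      ● ∧I (∧E₁ (∧E₂ (∀E (∀E h2 v2) v1) ● h1)) (∧E₁ (∧E₂ (∀E (∀E h2 v1) v0) ● h0)))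
    -- For levels `p < q < r`: if `r ≤ p`, then `q ≤ r` would give `q ≤ p`, contrary to `p < q`.
    (⊃I (∧E₂ (∧E₂ (∀E (∀E h3 v2) v1) ● h2) ●
      (∀E (∀E (∀E (∧E₁ (∧E₂ h4)) (snd · v1)) (snd · v0)) (snd · v2)
        ● ∧I (∧E₁ (∧E₂ (∀E (∀E h3 v1) v0) ● h1)) h0))))))))))

-- After unfolding, the function occurs only in the outer test, and `F` is the mask given by the
-- order. Either `F` is 0, which makes both sides 0, or `snd q` is strictly below `j` and the
-- premise applies.
below-cong : {X Z Z′ : Tm Γ 𝟙} {j q : Tm Γ ι} →
             Φ ⊢ snd · q <⟨ X ⟩ j ⊃ Z · q ≐ Z′ · q →
             Φ ⊢ below · X · Z · j · q ≐ below · X · Z′ · j · q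
below-cong {Γ} {Φ} {X} {Z} {Z′} {j} {q} p = unfold Z ⊙ byCases (dist (X · ⟨ snd · q , j ⟩) one)
  (byCases (dist (X · ⟨ j , snd · q ⟩) one)
    (vanish (ifzO _ _ h1 ⊙ ifzO _ _ h0))
    (ifz-cong F O (ap₂≐ plus (ap₂≐ monus agree′ refl≐) (ap₂≐ monus refl≐ agree′))))
  (vanish (ifzS _ _ h0))
  ⊙ sym≐ (unfold Z′)
  where
  agree′ = wk∷ (wk∷ p) ● ∧I (dist≡0⇒≡ h1) (⊃I (S≢O (sym≐ h1 ⊙ dist≡0 h0)))
  F = ifz (dist (X · ⟨ snd · q , j ⟩) one) (ifz (dist (X · ⟨ j , snd · q ⟩) one) O one) O
  body : Tm (ι ∷ ι ∷ 𝟙 ∷ 𝟙 ∷ Γ) ι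
  body = ifz (dist (v2 · v0) one)
    (ifz (dist (v3 · ⟨ snd · v0 , v1 ⟩) one)
      (ifz (dist (v3 · ⟨ v1 , snd · v0 ⟩) one) O one)
      O)
    O
  unfold : (Z : Tm Γ 𝟙) → Φ ⊢ below · X · Z · j · q ≐ ifz (dist (Z · q) one) F O
  unfold Z = app≈ (below · X · Z · j) (subT (var ▹ X ▹ Z ▹ j) (lam body)) (β₃ (lam body) var X Z j) q
    ⊙ β body (var ▹ X ▹ Z ▹ j) q
  vanish : ∀ {Ψ} → Ψ ⊢ F ≐ O → Ψ ⊢ ifz (dist (Z · q) one) F O ≐ ifz (dist (Z′ · q) one) F O
  vanish e = ifz-O e ⊙ sym≐ (ifz-O e)
    where
    ifz-O : ∀ {Ψ} {t u : Tm Γ ι} → Ψ ⊢ u ≐ O → Ψ ⊢ ifz t u O ≐ O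
    ifz-O {t = t} e = byCases t (ifzO _ _ h0 ⊙ wk∷ e) (ifzS _ _ h0)

BelowSpec : Tm Γ (𝟙 ⇒ ι ⇒ 𝟙) → Tm Γ Rel → Fm Γ
BelowSpec b L = ∀̇ 𝟙 (∀̇ 𝟙 (∀̇ ι
  (∀̇ ι (L ↑ ↑ ↑ ↑ · v0 · v1 ≐ O ⊃ v3 · v0 ≐ v2 · v0) ⊃
   ∀̇ ι (b ↑ ↑ ↑ ↑ · v3 · (snd · v1) · v0 ≐ b ↑ ↑ ↑ ↑ · v2 · (snd · v1) · v0))))

below-spec : [] {A = Fm (Rel ∷ 𝟙 ∷ [])} ⊢ OrderSpec v0 v1 ⊃ BelowSpec (below · v1) v0
below-spec = ⊃I (∀I (∀I (∀I (⊃I (∀I (below-cong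
  (⊃I (∀E h1 v0 ● (∧E₁ (∀E (∀E h2 v0) v1) ● h0)))))))))

below-determines : [] {A = Fm (Jmp ∷ Rel ∷ (𝟙 ⇒ ι ⇒ ι ⇒ ι) ∷ (𝟙 ⇒ ι ⇒ 𝟙) ∷ [])} ⊢
  IterSpec v0 v2 v3 ⊃ BelowSpec v3 v1 ⊃ Det v0 v1
below-determines = ⊃I (⊃I (∀I (∀I (∀I (⊃I
  (∀E (∀E h2 v2) v0 ⊙
   app≈ (v5 · (v6 · v2 · (snd · v0)) · (fst · v0)) (v5 · (v6 · v1 · (snd · v0)) · (fst · v0))
     (app≈ (v5 · (v6 · v2 · (snd · v0))) (v5 · (v6 · v1 · (snd · v0)))
       -- The restrictions are only known to be pointwise equal; extensionality carries this through
       -- the jump.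
       (ap≈ v5 (v6 · v2 · (snd · v0)) (v6 · v1 · (snd · v0))
         (∀E (∀E (∀E h1 v2) v1) v0 ● h0)) (fst · v0)) (snd · v0) ⊙
   sym≐ (∀E (∀E h2 v1) v0)))))))

H-intro : ∀ {θ} (j : Tm Γ (𝟙 ⇒ ι ⇒ ι ⇒ ι)) (X Z : Tm Γ 𝟙) → Φ ⊢ JumpSpec θ j X → Φ ⊢ IsSet Z →
          Φ ⊢ ∀̇ ι (∀̇ ι (Z ↑ ↑ · ⟨ v1 , v0 ⟩ ≐ j ↑ ↑ · (below · X ↑ ↑ · Z ↑ ↑ · v0) · v1 · v0)) →
          Φ ⊢ H θ X Z
H-intro j X Z p q r = ∧I q (∀I (∀I (∧I
  (⊃I (wk∷ (∧E₁ (∧E₁ spec)) ● (sym≐ (wk∷ value) ⊙ h0)))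
  (⊃I (wk∷ value ⊙ (wk∷ (∧E₂ (∧E₁ spec)) ● h0))))))
  where
  spec = jump-at (j ↑ ↑) (X ↑ ↑) (wk-JumpSpec (j ↑) (X ↑) (wk-JumpSpec j X p))
           (below · X ↑ ↑ · Z ↑ ↑ · v0) v1 v0
  value = ∀-wk (∀-wk r)

J≤one : [] {A = Fm (Jmp ∷ (𝟙 ⇒ ι ⇒ ι ⇒ ι) ∷ (𝟙 ⇒ ι ⇒ 𝟙) ∷ [])} ⊢
  IterSpec v0 v1 v2 ⊃ ∀̇ 𝟙 (∀̇ ι (∀̇ ι (v4 · v2 · v1 · v0 ≤̇ one))) ⊃
  ∀̇ 𝟙 (∀̇ ι (v2 · v1 · v0 ≤̇ one))
J≤one = ⊃I (⊃I (∀I (∀I (ap₂≐ monus (∀E (∀E h1 v1) v0) refl≐ ⊙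
  ∀E (∀E (∀E h0 (v4 · v1 · (snd · v0))) (fst · v0)) (snd · v0)))))

-- Evaluating the fixed point equation at a pair and cancelling the projections yields the recursive
-- clause of `H`.
fixed-point : [] {A = Fm (Jmp ∷ (𝟙 ⇒ ι ⇒ ι ⇒ ι) ∷ (𝟙 ⇒ ι ⇒ 𝟙) ∷ [])} ⊢
  IterSpec v0 v1 v2 ⊃ ∀̇ 𝟙 (∀̇ ι (v2 · v1 · v0 ≤̇ one)) ⊃
  ∀̇ 𝟙 (∀̇ ι (ok v2 v1 v0) ⊃ IsSet v0 ∧̇
    ∀̇ ι (∀̇ ι (v2 · ⟨ v1 , v0 ⟩ ≐ v4 · (v5 · v2 · v0) · v1 · v0)))
fixed-point = ⊃I (⊃I (∀I (⊃I (∧I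
  (∀I (ap₂≐ monus (∀E h0 v0) refl≐ ⊙ ∀E (∀E h1 v1) v0))
  (∀I (∀I (∀E h0 ⟨ v1 , v0 ⟩ ⊙ ∀E (∀E h2 v2) ⟨ v1 , v0 ⟩ ⊙
    cong≈ (v4 · (v5 · v2 · (snd · ⟨ v1 , v0 ⟩)) · (fst · ⟨ v1 , v0 ⟩)) (v4 · (v5 · v2 · v0) · v1)
      (snd · ⟨ v1 , v0 ⟩) v0
      (cong≈ (v4 · (v5 · v2 · (snd · ⟨ v1 , v0 ⟩))) (v4 · (v5 · v2 · v0))
        (fst · ⟨ v1 , v0 ⟩) v1
        (ap≈ v4 (v5 · v2 · (snd · ⟨ v1 , v0 ⟩)) (v5 · v2 · v0) (ap≐ (v5 · v2) (snd-pair v1 v0)))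
        (fst-pair v1 v0))
      (snd-pair v1 v0))))))))

-- The functional G, the uncovered function W and the descending sequence

-- The successor is taken because an initial segment must have length `p + 1` to contain the value
-- at `p`.
modulus-correct : [] {A = Fm (𝟚 ∷ 𝟚 ∷ Rel ∷ Jmp ∷ [])} ⊢
  ∀̇ 𝟙 (∃̇ ι (minBad v5 v4 v1 v0) ⊃ ∃̇ ι (v3 · v1 ≐ v0 ∧̇ minBad v5 v4 v1 v0)) ⊃
  ∀̇ 𝟙 (v1 · v0 ≐ Sc · (v2 · v0)) ⊃
  ∀̇ 𝟙 (∃̇ ι (minBad v5 v4 v1 v0) ⊃ ∃̇ ι (v2 · v1 ≐ Sc · v0 ∧̇ minBad v5 v4 v1 v0))
modulus-correct = ⊃I (⊃I (∀I (⊃I (∃E (∀E h2 v0 ● h0)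
  (∃I v0 (∧I (∀E h2 v1 ⊙ S≐ (∧E₁ h0)) (∧E₂ h0)))))))

diagonal-correct : [] {A = Fm (𝟙 ∷ 𝟙 ∷ Seqs ∷ Rel ∷ Jmp ∷ [])} ⊢
  ∀̇ ι (∃̇ ι (okBelow v6 v5 (v4 · v0) v1) ⊃ ∃̇ ι (v3 · v1 ≐ v0 ∧̇ okBelow v6 v5 (v4 · v0) v1)) ⊃
  ∀̇ ι (v1 · v0 ≐ v5 · (v3 · (v2 · v0)) · v0) ⊃
  ∀̇ ι (∃̇ ι (okBelow v6 v5 (v4 · v0) v1) ⊃
        ∃̇ ι (v2 · v1 ≐ v6 · (v4 · v0) · v1 ∧̇ okBelow v6 v5 (v4 · v0) v1))
diagonal-correct = ⊃I (⊃I (∀I (⊃I (∃E (∀E h2 v0 ● h0)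
  (∃I v0 (∧I
    (∀E h2 v1 ⊙ app≈ (v6 · (v4 · (v3 · v1))) (v6 · (v4 · v0))
      (ap≈ v6 (v4 · (v3 · v1)) (v4 · v0) (ap≐ v4 (∧E₁ h0))) v1)
    (∧E₂ h0)))))))

diagonal≤one : [] {A = Fm (𝟙 ∷ 𝟙 ∷ Seqs ∷ Jmp ∷ [])} ⊢
  ∀̇ 𝟙 (∀̇ ι (v5 · v1 · v0 ≤̇ one)) ⊃ ∀̇ ι (v1 · v0 ≐ v4 · (v3 · (v2 · v0)) · v0) ⊃ v0 ≤₁one
diagonal≤one = ⊃I (⊃I (∀I (ap₂≐ monus (∀E h0 v0) refl≐ ⊙ ∀E (∀E h1 (v3 · (v2 · v0))) v0)))

bad-progress : [] {A = Fm (𝟙 ∷ Seqs ∷ Rel ∷ Jmp ∷ [])} ⊢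
  Trans v2 ⊃ Det v3 v2 ⊃ ∀̇ ι (Bad v4 v3 v2 v0 ⇔̇ v1 · v0 ≐ O) ⊃
  ∀̇ ι (v1 · v0 ≐ O ⊃ ∃̇ ι (v2 · v0 ≐ O ∧̇ v4 · v0 · v1 ≐ O))
bad-progress = ⊃I (⊃I (⊃I (∀I (⊃I
  (∃E (at⟨ (λ ()) ▹ v4 ▹ v3 ▹ v2 ▹ v0 ⟩ progress ● h3 ● h2 ● (∧E₂ (∀E h1 v0) ● h0))
    (∃I v0 (∧I (∧E₁ (∀E h2 v0) ● ∧E₁ h0) (∧E₂ h0))))))))

no-bad : [] {A = Fm (𝟙 ∷ Seqs ∷ Rel ∷ Jmp ∷ [])} ⊢
  ∀̇ ι (Bad v4 v3 v2 v0 ⇔̇ v1 · v0 ≐ O) ⊃ ∀̇ ι (¬̇ (v1 · v0 ≐ O)) ⊃ ∀̇ ι (¬̇ Bad v4 v3 v2 v0)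
no-bad = ⊃I (⊃I (∀I (⊃I (∀E h1 v0 ● (∧E₁ (∀E h2 v0) ● h0)))))

iterate-spec : [] {A = Fm (𝟙 ∷ Rel ∷ 𝟙 ∷ ι ∷ [])} ⊢
  ∀̇ ι (v1 · v0 ≐ R · v0 · v4 · v2) ⊃ ∀̇ ι (∀̇ ι (v3 · v1 · v0 ≐ v4 · v1)) ⊃
  v0 · O ≐ v3 ∧̇ ∀̇ ι (v1 · (Sc · v0) ≐ v3 · (v1 · v0))
iterate-spec = ⊃I (⊃I (∧I
  (∀E h1 O ⊙ ax (R-O _ _))
  (∀I (∀E h1 (Sc · v0) ⊙ ax (R-Sc _ _ _) ⊙ ∀E (∀E h0 (R · v0 · v4 · v2)) v0
       ⊙ ap≐ v3 (sym≐ (∀E h1 v0))))))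

-- Bad places are codes of pairs compared by their second components, whereas `WO` concerns `X`
-- itself; hence the sequence to be tested consists of the second components.
not-descending : [] {A = Fm (𝟙 ∷ 𝟙 ∷ Rel ∷ 𝟙 ∷ [])} ⊢
  OrderSpec v2 v3 ⊃ ∀̇ ι (v1 · v0 ≐ snd · (v2 · v0)) ⊃
  ¬̇ ∀̇ ι (v1 · (Sc · v0) <⟨ v4 ⟩ v1 · v0) ⊃
  ¬̇ ∀̇ ι (v3 · (v2 · (Sc · v0)) · (v2 · v0) ≐ O)
not-descending = ⊃I (⊃I (⊃I (⊃I (h1 ● ∀I (∧I
  (ap≐ v4 (ap₂≐ pair (∀E h2 (Sc · v0)) (∀E h2 v0))
   ⊙ ∧E₁ (∧E₂ (∀E (∀E h3 (v2 · (Sc · v0))) (v2 · v0)) ● ∀E h0 v0))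
  (⊃I (∧E₂ (∧E₂ (∀E (∀E h4 (v2 · (Sc · v0))) (v2 · v0)) ● ∀E h1 v0)
    ● (ap≐ v4 (ap₂≐ pair (sym≐ (∀E h3 v0)) (sym≐ (∀E h3 (Sc · v0)))) ⊙ h0))))))))

cover : [] {A = Fm (𝟙 ∷ 𝟚 ∷ 𝟚 ⇒ 𝟙 ⋆ ∷ [])} ⊢
  SFF v2 ⊃ v0 ≤₁one ⊃
  ∃̇ ι (v0 <̇ len · (v3 · v2) ∧̇
    ∀̇ ι (v3 · (at · (v4 · v3) · v1) ≐ Sc · v0 ⊃ v2 · v0 ≐ at · (v4 · v3) · v1 · v0))
cover = ⊃I (⊃I (∃E (∀E (∀E h1 v1) v0 ● h0) (∃E (∧E₁ h0) (∃I v0 (∧I (∧E₁ h0) (∀I (⊃I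
  -- The segment has length `p + 1`, so `p` is its last index.
  (∀E (∧E₂ h2) v0 ● (ap₂≐ monus refl≐ (ax (len-seq _ _) ⊙ length) ⊙ n∸n _)
   ⊙ ax (at-seq (v4 · v2) v0 v2) ● (ap₂≐ monus refl≐ length ⊙ n∸n _)
   ⊙ ∀E (∧E₂ h1) v0))))))))
  where
  length : {φ : Fm (ι ∷ ι ∷ 𝟙 ∷ 𝟙 ∷ 𝟚 ∷ 𝟚 ⇒ 𝟙 ⋆ ∷ [])} →
    (v4 · (at · (v5 · v4) · v1) ≐ Sc · v0) ∷ (φ ∧̇ v2 ≈ at · (v5 · v4) · v1) ∷ Φ ⊢ v4 · v2 ≐ Sc · v0
  -- Membership is equality with an entry up to `≈`, so `G` has the same value at both by
  -- extensionality.
  length = ap≈ v4 v2 (at · (v5 · v4) · v1) (∧E₂ h1) ⊙ h0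

hit : [] {A = Fm (𝟚 ⇒ 𝟙 ⋆ ∷ 𝟚 ∷ 𝟙 ∷ Jmp ∷ [])} ⊢
  ∃̇ ι (v0 <̇ len · (v1 · v2) ∧̇
    ∀̇ ι (v3 · (at · (v2 · v3) · v1) ≐ Sc · v0 ⊃ v4 · v0 ≐ at · (v2 · v3) · v1 · v0)) ⊃
  ∀̇ ι (∀̇ ι (v3 · (at · (v2 · v3) · v1) ≐ Sc · v0 ⊃ v4 · v0 ≐ at · (v2 · v3) · v1 · v0) ⊃
        ∀̇ ι (ok v5 (at · (v2 · v3) · v1) v0)) ⊃
  ∃∈ (v0 · v1) (∀̇ ι (ok v5 v1 v0))
hit = ⊃I (⊃I (∃E h1 (∃I (at · (v1 · v2) · v0) (∧I
  (∃I v0 (∧I (∧E₁ h0) (∀I refl≐))) (∀E h1 v0 ● ∧E₂ h0)))))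

-- Membership in sequences

∈̇I : (g : Tm Γ τ) (w : Tm Γ (τ ⋆)) (n : Tm Γ ι) →
     Φ ⊢ n <̇ len · w → Φ ⊢ g ≈ at · w · n → Φ ⊢ g ∈̇ w
∈̇I {τ = τ} g w n p q = ∃I n (∧I
  (⊢≡ (cong (λ w → n <̇ len · w) (sym (inst-↑ n w))) p)
  (⊢≡ (sym (trans (subF-eq (inst n) τ _ _)
    (cong₂ (λ g w → g ≈ at · w · n) (inst-↑ n g) (inst-↑ n w)))) q))

subF-∈̇ : (s : Sub Γ Δ) (g : Tm Γ τ) (w : Tm Γ (τ ⋆)) → subF s (g ∈̇ w) ≡ (subT s g ∈̇ subT s w)
subF-∈̇ {τ = τ} s g w = cong₂ (λ φ ψ → ∃̇ ι (φ ∧̇ ψ))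
  (cong (λ w → v0 <̇ len · w) (subT-lift-↑ s w))
  (trans (subF-eq (lift s) τ _ _)
    (cong₂ (λ g w → g ≈ at · w · v0) (subT-lift-↑ s g) (subT-lift-↑ s w)))

∀∈E : (g : Tm Γ τ) (w : Tm Γ (τ ⋆)) → Φ ⊢ ∀∈ w φ → Φ ⊢ g ∈̇ w → Φ ⊢ φ [ g ]
∀∈E {φ = φ} g w p q = ⊃E
  (⊢≡ (cong (_⊃ φ [ g ]) (trans (subF-∈̇ (inst g) v0 (w ↑)) (cong (g ∈̇_) (inst-↑ g w)))) (∀E p g)) q

-- A closed realiser applied to its arguments is only provably equal to the term from which it was
-- abstracted.
∈̇-resp : (g : Tm Γ τ) (w w′ : Tm Γ (τ ⋆)) → Φ ⊢ w ≈ w′ → Φ ⊢ g ∈̇ w → Φ ⊢ g ∈̇ w′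
∈̇-resp g w w′ p q = ∃-map (∧I
    (ap₂≐ monus refl≐ (sym≐ (ap≈ len (w ↑) (w′ ↑) p′)) ⊙ ∧E₁ h0)
    (trans≈ (g ↑) (at · w ↑ · v0) (at · w′ ↑ · v0) (∧E₂ h0)
      (app≈ (at · w ↑) (at · w′ ↑) (ap≈ at (w ↑) (w′ ↑) p′) v0)))
  q
  where
  p′ = wk∷ (wk≈ w w′ p)

∃∈-resp : (w w′ : Tm Γ (τ ⋆)) → Φ ⊢ w ≈ w′ → Φ ⊢ ∃∈ w φ → Φ ⊢ ∃∈ w′ φ
∃∈-resp w w′ p q = ∃-map
  (∧I (∈̇-resp v0 (w ↑) (w′ ↑) (wk∷ (wk≈ w w′ p)) (∧E₁ h0)) (∧E₂ h0)) q

singleton-∈̇ : (g : Tm Γ τ) → Φ ⊢ g ∈̇ seq · one · (K · g)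
singleton-∈̇ g = ∈̇I g w O p
  (sym≈ (at · w · O) g (trans≈ (at · w · O) (K · g · O) g
    (⊃E (ax (at-seq one O (K · g))) (n∸n one)) (ax (K-eq g O))))
  where
  w = seq · one · (K · g)
  p = ap₂≐ monus refl≐ (ax (len-seq one (K · g))) ⊙ n∸n one

-- Realisers

okBelowArith : (J : Tm Γ Jmp) (L : Tm Γ Rel) (Z : Tm Γ 𝟙) (p : Tm Γ ι) → Arith (okBelow J L Z p)
okBelowArith J L Z p = all (imp atom atom)

minBadArith : (J : Tm Γ Jmp) (L : Tm Γ Rel) (Z : Tm Γ 𝟙) (p : Tm Γ ι) → Arith (minBad J L Z p)
minBadArith J L Z p = and (imp atom bot) (okBelowArith J L Z p)

badArith : (J : Tm Γ Jmp) (L : Tm Γ Rel) (V : Tm Γ Seqs) (p : Tm Γ ι) → Arith (Bad J L V p)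
badArith J L V p = or
  (ex (and (imp atom bot) (all (imp (minBadArith (J ↑ ↑) (L ↑ ↑) ((V ↑ · v0) ↑) v0) bot))))
  (ex (ex (and (okBelowArith (J ↑ ↑) (L ↑ ↑) (V ↑ ↑ · v1) (p ↑ ↑)) (and atom
          (and (okBelowArith (J ↑ ↑) (L ↑ ↑) (V ↑ ↑ · v0) (p ↑ ↑)) (and atom (imp atom bot)))))))

abstract

  firstBad : Tm Γ 𝟚 → Tm Γ Jmp → Tm Γ Rel → Tm Γ 𝟚
  firstBad μ J L = choice μ (minBadArith (J ↑ ↑) (L ↑ ↑) v1 v0)

  firstBad-def : (μ : Tm Γ 𝟚) (J : Tm Γ Jmp) (L : Tm Γ Rel) → Φ ⊢ MU μ →
    Φ ⊢ ∀̇ 𝟙 (∃̇ ι (minBad (J ↑ ↑) (L ↑ ↑) v1 v0) ⊃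
              ∃̇ ι (firstBad μ J L ↑ ↑ · v1 ≐ v0 ∧̇ minBad (J ↑ ↑) (L ↑ ↑) v1 v0))
  firstBad-def μ J L = choice-spec μ (minBadArith (J ↑ ↑) (L ↑ ↑) v1 v0)

  modulus : Tm Γ 𝟚 → Tm Γ 𝟚
  modulus c = lam (Sc · (c ↑ · v0))

  modulus-def : (c : Tm Γ 𝟚) → Φ ⊢ ∀̇ 𝟙 (modulus c ↑ · v0 ≐ Sc · (c ↑ · v0))
  modulus-def c = ∀I (lam-β (Sc · (c ↑ · v0)))

  correctBelow : Tm Γ 𝟚 → Tm Γ Jmp → Tm Γ Rel → Tm Γ Seqs → Tm Γ 𝟙
  correctBelow μ J L V = choice μ (okBelowArith (J ↑ ↑) (L ↑ ↑) (V ↑ ↑ · v0) v1)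

  correctBelow-def : (μ : Tm Γ 𝟚) (J : Tm Γ Jmp) (L : Tm Γ Rel) (V : Tm Γ Seqs) → Φ ⊢ MU μ →
    Φ ⊢ ∀̇ ι (∃̇ ι (okBelow (J ↑ ↑) (L ↑ ↑) (V ↑ ↑ · v0) v1) ⊃
              ∃̇ ι (correctBelow μ J L V ↑ ↑ · v1 ≐ v0 ∧̇ okBelow (J ↑ ↑) (L ↑ ↑) (V ↑ ↑ · v0) v1))
  correctBelow-def μ J L V = choice-spec μ (okBelowArith (J ↑ ↑) (L ↑ ↑) (V ↑ ↑ · v0) v1)

  -- The function `W`. Where no candidate is right below the place, the index is whatever `μ`
  -- returns, but the value is still a value of `J` and so at most 1.
  diagonal : Tm Γ Jmp → Tm Γ Seqs → Tm Γ 𝟙 → Tm Γ 𝟙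
  diagonal J V k = lam (J ↑ · (V ↑ · (k ↑ · v0)) · v0)

  diagonal-def : (J : Tm Γ Jmp) (V : Tm Γ Seqs) (k : Tm Γ 𝟙) →
    Φ ⊢ ∀̇ ι (diagonal J V k ↑ · v0 ≐ J ↑ · (V ↑ · (k ↑ · v0)) · v0)
  diagonal-def J V k = ∀I (lam-β (J ↑ · (V ↑ · (k ↑ · v0)) · v0))

  bad : Tm Γ 𝟚 → Tm Γ Jmp → Tm Γ Rel → Tm Γ Seqs → Tm Γ 𝟙
  bad μ J L V = charFun μ (badArith (J ↑) (L ↑) (V ↑) v0)

  bad-def : (μ : Tm Γ 𝟚) (J : Tm Γ Jmp) (L : Tm Γ Rel) (V : Tm Γ Seqs) → Φ ⊢ MU μ →
    Φ ⊢ ∀̇ ι (Bad (J ↑) (L ↑) (V ↑) v0 ⇔̇ bad μ J L V ↑ · v0 ≐ O)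
  bad-def μ J L V = charFun-spec μ (badArith (J ↑) (L ↑) (V ↑) v0)

  root : Tm Γ 𝟚 → Tm Γ 𝟙 → Tm Γ ι
  root μ a = pick μ (atom {t = a ↑ · v0} {O})

  root-def : (μ : Tm Γ 𝟚) (a : Tm Γ 𝟙) → Φ ⊢ MU μ →
    Φ ⊢ ∃̇ ι (a ↑ · v0 ≐ O) ⊃ ∃̇ ι (root μ a ↑ ≐ v0 ∧̇ a ↑ · v0 ≐ O)
  root-def μ a = pick-∃ μ atom

  lowerRoot : Tm Γ 𝟚 → Tm Γ Rel → Tm Γ 𝟙 → Tm Γ 𝟙
  lowerRoot μ L a = choice μ (and (atom {t = a ↑ ↑ · v0} {O}) (atom {t = L ↑ ↑ · v0 · v1} {O}))

  lowerRoot-def : (μ : Tm Γ 𝟚) (L : Tm Γ Rel) (a : Tm Γ 𝟙) → Φ ⊢ MU μ →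
    Φ ⊢ ∀̇ ι (∃̇ ι (a ↑ ↑ · v0 ≐ O ∧̇ L ↑ ↑ · v0 · v1 ≐ O) ⊃
              ∃̇ ι (lowerRoot μ L a ↑ ↑ · v1 ≐ v0 ∧̇ a ↑ ↑ · v0 ≐ O ∧̇ L ↑ ↑ · v0 · v1 ≐ O))
  lowerRoot-def μ L a = choice-spec μ (and atom atom)

  -- The recursor also passes the stage to its step function; plain iteration discards it.
  ignoring : Tm Γ 𝟙 → Tm Γ Rel
  ignoring N = lam (lam (N ↑ ↑ · v1))

  ignoring-def : (N : Tm Γ 𝟙) → Φ ⊢ ∀̇ ι (∀̇ ι (ignoring N ↑ ↑ · v1 · v0 ≐ N ↑ ↑ · v1))
  ignoring-def N = ∀I (∀I (lam-β₂ (N ↑ ↑ · v1)))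

  recursion : Tm Γ ι → Tm Γ Rel → Tm Γ 𝟙
  recursion z e = lam (R · v0 · z ↑ · e ↑)

  recursion-def : (z : Tm Γ ι) (e : Tm Γ Rel) →
    Φ ⊢ ∀̇ ι (recursion z e ↑ · v0 ≐ R · v0 · z ↑ · e ↑)
  recursion-def z e = ∀I (lam-β (R · v0 · z ↑ · e ↑))

  levels : Tm Γ 𝟙 → Tm Γ 𝟙
  levels d = lam (snd · (d ↑ · v0))

  levels-def : (d : Tm Γ 𝟙) → Φ ⊢ ∀̇ ι (levels d ↑ · v0 ≐ snd · (d ↑ · v0))
  levels-def d = ∀I (lam-β (snd · (d ↑ · v0)))

-- Here `a` is the characteristic function of the bad places, `z` a chosen bad place, `N` a choice
-- of smaller ones, `e` the recursion step made from `N`, and `d` the resulting sequence.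
no-bad-candidate : (J : Tm Γ Jmp) (L : Tm Γ Rel) (V : Tm Γ Seqs)
  (a : Tm Γ 𝟙) (z : Tm Γ ι) (N : Tm Γ 𝟙) (e : Tm Γ Rel) (d : Tm Γ 𝟙) →
  Φ ⊢ Trans L → Φ ⊢ Det J L →
  Φ ⊢ ∀̇ ι (Bad (J ↑) (L ↑) (V ↑) v0 ⇔̇ a ↑ · v0 ≐ O) →
  Φ ⊢ ∃̇ ι (a ↑ · v0 ≐ O) ⊃ ∃̇ ι (z ↑ ≐ v0 ∧̇ a ↑ · v0 ≐ O) →
  Φ ⊢ ∀̇ ι (∃̇ ι (a ↑ ↑ · v0 ≐ O ∧̇ L ↑ ↑ · v0 · v1 ≐ O) ⊃
            ∃̇ ι (N ↑ ↑ · v1 ≐ v0 ∧̇ a ↑ ↑ · v0 ≐ O ∧̇ L ↑ ↑ · v0 · v1 ≐ O)) →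
  Φ ⊢ ∀̇ ι (∀̇ ι (e ↑ ↑ · v1 · v0 ≐ N ↑ ↑ · v1)) →
  Φ ⊢ ∀̇ ι (d ↑ · v0 ≐ R · v0 · z ↑ · e ↑) →
  Φ ⊢ ¬̇ ∀̇ ι (L ↑ · (d ↑ · (Sc · v0)) · (d ↑ · v0) ≐ O) →
  Φ ⊢ ∀̇ ι (¬̇ Bad (J ↑) (L ↑) (V ↑) v0)
no-bad-candidate J L V a z N e d T D a-def z-def N-def e-def d-def nd =
  at⟨ (λ ()) ▹ J ▹ L ▹ V ▹ a ⟩ no-bad ● a-def ●
    (at⟨ (λ ()) ▹ L ▹ a ▹ z ▹ N ▹ d ⟩ descent ● z-def ● N-def ● ∧E₁ d-eqs ● ∧E₂ d-eqs
      ● (at⟨ (λ ()) ▹ J ▹ L ▹ V ▹ a ⟩ bad-progress ● T ● D ● a-def) ● nd)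
  where
  d-eqs = at⟨ (λ ()) ▹ z ▹ N ▹ e ▹ d ⟩ iterate-spec ● d-def ● e-def

-- Here `c` chooses minimal errors and `G` is its successor; `k` chooses the index of a candidate
-- that is right below a given place, and `W` is the diagonal function made from `k`.
fixed-point-exists : (Θ : Tm Γ (𝟚 ⇒ 𝟙 ⋆)) (J : Tm Γ Jmp) (L : Tm Γ Rel) (c G : Tm Γ 𝟚) (k W : Tm Γ 𝟙) →
  let V = at · (Θ · G) in
  Φ ⊢ SFF Θ → Φ ⊢ Trans L → Φ ⊢ Det J L →
  Φ ⊢ ∀̇ 𝟙 (∀̇ ι (J ↑ ↑ · v1 · v0 ≤̇ one)) →
  Φ ⊢ ∀̇ ι (¬̇ Bad (J ↑) (L ↑) (V ↑) v0) →
  Φ ⊢ ∀̇ 𝟙 (∃̇ ι (minBad (J ↑ ↑) (L ↑ ↑) v1 v0) ⊃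
            ∃̇ ι (c ↑ ↑ · v1 ≐ v0 ∧̇ minBad (J ↑ ↑) (L ↑ ↑) v1 v0)) →
  Φ ⊢ ∀̇ 𝟙 (G ↑ · v0 ≐ Sc · (c ↑ · v0)) →
  Φ ⊢ ∀̇ ι (∃̇ ι (okBelow (J ↑ ↑) (L ↑ ↑) (V ↑ ↑ · v0) v1) ⊃
            ∃̇ ι (k ↑ ↑ · v1 ≐ v0 ∧̇ okBelow (J ↑ ↑) (L ↑ ↑) (V ↑ ↑ · v0) v1)) →
  Φ ⊢ ∀̇ ι (W ↑ · v0 ≐ J ↑ · (V ↑ · (k ↑ · v0)) · v0) →
  Φ ⊢ ∃∈ (Θ · G) (∀̇ ι (ok (J ↑ ↑) v1 v0))
fixed-point-exists Θ J L c G k W sff T D J≤1 nb c-def G-def k-def W-def =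
  at⟨ (λ ()) ▹ J ▹ W ▹ G ▹ Θ ⟩ hit
    ● (at⟨ (λ ()) ▹ Θ ▹ G ▹ W ⟩ cover ● sff
        ● (at⟨ (λ ()) ▹ J ▹ V ▹ k ▹ W ⟩ diagonal≤one ● J≤1 ● W-def))
    ● (at⟨ (λ ()) ▹ J ▹ L ▹ V ▹ G ▹ W ⟩ covered ● T ● D ● nb
        ● (at⟨ (λ ()) ▹ J ▹ L ▹ c ▹ G ⟩ modulus-correct ● c-def ● G-def)
        ● (at⟨ (λ ()) ▹ J ▹ L ▹ V ▹ k ▹ W ⟩ diagonal-correct ● k-def ● W-def))
  where
  V = at · (Θ · G)

H-exists : ∀ θ (w : Tm Γ (𝟙 ⋆)) (X : Tm Γ 𝟙) (j : Tm Γ (𝟙 ⇒ ι ⇒ ι ⇒ ι)) (J : Tm Γ Jmp) →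
  Φ ⊢ JumpSpec θ j X → Φ ⊢ IterSpec J j (below · X) → Φ ⊢ ∀̇ 𝟙 (∀̇ ι (J ↑ ↑ · v1 · v0 ≤̇ one)) →
  Φ ⊢ ∃∈ w (∀̇ ι (ok (J ↑ ↑) v1 v0)) → Φ ⊢ ∃∈ w (H θ (X ↑) v0)
H-exists θ w X j J j-spec J-spec J≤1 = ∃-map (∧I (∧E₁ h0)
  (H-intro (j ↑) (X ↑) v0 (wk∷ (wk-JumpSpec j X j-spec)) (∧E₁ fp) (∧E₂ fp)))
  where
  fp = wk∷ (∀-wk (at⟨ (λ ()) ▹ below · X ▹ j ▹ J ⟩ fixed-point ● J-spec ● J≤1)) ● ∧E₂ h0

candidates : Tm Γ 𝟙 → Tm Γ 𝟚 → Tm Γ (𝟚 ⇒ 𝟙 ⋆) → Tm Γ (𝟙 ⋆)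
candidates X μ Θ = Θ · modulus (firstBad μ (iter (jump μ X) (below · X)) (order μ X))

badAmong : Tm Γ 𝟙 → Tm Γ 𝟚 → Tm Γ (𝟚 ⇒ 𝟙 ⋆) → Tm Γ 𝟙
badAmong X μ Θ = bad μ (iter (jump μ X) (below · X)) (order μ X) (at · candidates X μ Θ)

descending : Tm Γ 𝟚 → Tm Γ Rel → Tm Γ 𝟙 → Tm Γ 𝟙
descending μ L a = recursion (root μ a) (ignoring (lowerRoot μ L a))

testSequence : Tm Γ 𝟙 → Tm Γ 𝟚 → Tm Γ (𝟚 ⇒ 𝟙 ⋆) → Tm Γ 𝟙
testSequence X μ Θ = levels (descending μ (order μ X) (badAmong X μ Θ))

hierarchy : (X : Tm Γ 𝟙) (μ : Tm Γ 𝟚) (Θ : Tm Γ (𝟚 ⇒ 𝟙 ⋆)) →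
            Φ ⊢ MU μ → Φ ⊢ SFF Θ → Φ ⊢ WO (testSequence X μ Θ) X →
            Φ ⊢ ∃∈ (candidates X μ Θ) (H θ₀ (X ↑) v0)
hierarchy {Φ = Φ} X μ Θ m sff wo = H-exists θ₀ (candidates X μ Θ) X j J j-spec J-spec J≤1
  (fixed-point-exists Θ J L (firstBad μ J L) (modulus (firstBad μ J L)) k (diagonal J V k)
    sff T D J≤1 nb (firstBad-def μ J L m) (modulus-def (firstBad μ J L))
    (correctBelow-def μ J L V m) (diagonal-def J V k))
  where
  j = jump μ X
  J = iter j (below · X)
  L = order μ X
  V = at · candidates X μ Θ
  k = correctBelow μ J L V
  a = badAmong X μ Θ
  z = root μ a
  N = lowerRoot μ L a
  d = descending μ L a
  j-spec = jump-spec μ X m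
  J-spec = iter-spec j (below · X)
  L-spec = order-spec μ X m
  J≤1 = at⟨ (λ ()) ▹ below · X ▹ j ▹ J ⟩ J≤one ● J-spec
          ● ∀I (∀I (∀I (∧E₂ (∀-wk (∀-wk (∀-wk j-spec))))))
  T = at⟨ (λ ()) ▹ X ▹ L ⟩ order-trans ● ∧E₁ wo ● L-spec
  D = at⟨ (λ ()) ▹ below · X ▹ j ▹ L ▹ J ⟩ below-determines ● J-spec
        ● (at⟨ (λ ()) ▹ X ▹ L ⟩ below-spec ● L-spec)
  nb = no-bad-candidate J L V a z N (ignoring N) d T D
    (bad-def μ J L V m) (root-def μ a m) (lowerRoot-def μ L a m)
    (ignoring-def N) (recursion-def z (ignoring N))
    (at⟨ (λ ()) ▹ X ▹ L ▹ d ▹ levels d ⟩ not-descending ● L-spec ● levels-def d ● ∧E₂ wo)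

-- Closed realising terms

Params : Ctx
Params = 𝟙 ∷ 𝟚 ⇒ 𝟙 ⋆ ∷ 𝟚 ∷ []

-- The realisers take X, μ, Θ in this order, but Θ is bound before X in the theorem.
reorder : Sub Params (𝟚 ⇒ 𝟙 ⋆ ∷ 𝟚 ∷ 𝟙 ∷ [])
reorder = (λ ()) ▹ v1 ▹ v0 ▹ v2

abstract

  abstraction : Tm Params τ → Tm [] (𝟙 ⇒ 𝟚 ⇒ (𝟚 ⇒ 𝟙 ⋆) ⇒ τ)
  abstraction t = lam (lam (lam (subT reorder t)))

  abstraction-β : {Φ : List (Fm Params)} (t : Tm Params τ) → Φ ⊢ abstraction t ₀ · v0 · v2 · v1 ≈ t
  abstraction-β t = ⊢≡
    (cong (abstraction t ₀ · v0 · v2 · v1 ≈_)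
      (trans (subT-∘-cong _ reorder
        (λ { (here refl) → refl ; (there (here refl)) → refl ; (there (there (here refl))) → refl }) t)
        (subT-var t)))
    (β₃ (subT reorder t) (λ ()) v0 v2 v1)

X₀ : Tm Params 𝟙
X₀ = v0

Θ₀ : Tm Params (𝟚 ⇒ 𝟙 ⋆)
Θ₀ = v1

μ₀ : Tm Params 𝟚
μ₀ = v2

tests outputs : Tm Params (𝟙 ⋆)
tests = seq · one · (K · testSequence X₀ μ₀ Θ₀)
outputs = candidates X₀ μ₀ Θ₀

-- θ is a variable because otherwise the type checker would normalise run.
realised : ∀ θ →
  (∀ {Φ} → Φ ⊢ MU μ₀ → Φ ⊢ SFF Θ₀ → Φ ⊢ WO (testSequence X₀ μ₀ Θ₀) X₀ →
           Φ ⊢ ∃∈ outputs (H θ (X₀ ↑) v0)) →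
  E-PRAω⋆⊢
    ∀̇ 𝟚 (∀̇ (𝟚 ⇒ 𝟙 ⋆)
      (MU v1 ∧̇ SFF v0 ⊃
        ∀̇ 𝟙 (
          ∀∈ (abstraction tests ₀ · v0 · v2 · v1) (WO v0 v1) ⊃
          ∃∈ (abstraction outputs ₀ · v0 · v2 · v1) (H θ v1 v0))))
realised θ hierarchies = ∀I (∀I (⊃I (∀I (⊃I
  (∃∈-resp outputs o (sym≈ o outputs (abstraction-β outputs))
    (hierarchies (∧E₁ h1) (∧E₂ h1) (∀∈E (testSequence X₀ μ₀ Θ₀) i h0
      (∈̇-resp (testSequence X₀ μ₀ Θ₀) tests i (sym≈ i tests (abstraction-β tests))
        (singleton-∈̇ (testSequence X₀ μ₀ Θ₀))))))))))
  where
  i o : Tm Params (𝟙 ⋆)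
  i = abstraction tests ₀ · v0 · v2 · v1
  o = abstraction outputs ₀ · v0 · v2 · v1

corollary6p6 :
    Σ[ i ∈ Tm [] (𝟙 ⇒ 𝟚 ⇒ (𝟚 ⇒ 𝟙 ⋆) ⇒ 𝟙 ⋆) ]
    Σ[ o ∈ Tm [] (𝟙 ⇒ 𝟚 ⇒ (𝟚 ⇒ 𝟙 ⋆) ⇒ 𝟙 ⋆) ]
      (E-PRAω⋆⊢
        -- v1 is μ and v0 is Θ
        ∀̇ 𝟚 (∀̇ (𝟚 ⇒ 𝟙 ⋆)
          (MU v1 ∧̇ SFF v0 ⊃
            -- v2 is μ, v1 is Θ and v0 is X
            ∀̇ 𝟙 (
              -- v1 is X and v0 is g or Y
              ∀∈ (i ₀ · v0 · v2 · v1) (WO v0 v1) ⊃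
              ∃∈ (o ₀ · v0 · v2 · v1) (H θ₀ v1 v0)))))
corollary6p6 =
  abstraction tests ,, abstraction outputs ,, realised θ₀ (hierarchy X₀ μ₀ Θ₀)
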